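{- Let $M < 3$ be a real number, let $d > 0$ be an integer, and let $G$ be a finite simple graph with $\mathrm{mad}(G) < M$. If $d > \frac{2}{3-M} - 2$, then $V(G)$ can be partitioned into sets $A$ and $B$ such that $A$ is an independent set of $G$ and $G[B]$ is a forest each of whose connected components has at most $d+1$ vertices.
   Context: $\mathrm{mad}(G) := \max_{H \subseteq G,\, V(H)\neq\emptyset} \frac{2|E(H)|}{|V(H)|}$ (maximum average degree over nonempty subgraphs). -}

module Defs where

open import Data.Bool using (true; false)
open import Data.Empty using (⊥; ⊥-elim)
open import Data.Fin as Fin using (Fin; zero; suc; inject₁; fromℕ)
import Data.Fin.Properties as Fin
open import Data.Fin.Subset using (Subset; _∈_; _∩_; _∪_; Nonempty; Empty; ∣_∣) renaming (_⊆_ to _⊆ˢ_)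
open import Data.Fin.Subset.Properties
  using (_∈?_; nonempty?; x∈p∩q⁺; p∩q⊆p; p∩q⊆q; ⊆-antisym; p⊆q⇒∣p∣≤∣q∣; x∈⁅y⁆⇒x≡y; ∣⁅x⁆∣≡1)
import Data.Integer as ℤ
open import Data.List using (List; []; _∷_; length; filter; mapMaybe; allFin; cartesianProduct; cartesianProductWith)
import Data.List.Membership.Propositional as List
open import Data.List.Membership.Propositional.Properties using (∈-cartesianProductWith⁺; ∈-cartesianProductWith⁻)
open import Data.List.Properties using (filter-≐)
import Data.List.Relation.Unary.All as All
open import Data.List.Relation.Unary.Any using (here; there)
open import Data.Maybe using (Maybe; just; nothing)
open import Data.Nat as ℕ using (ℕ; zero; suc; NonZero)
import Data.Nat.Properties as ℕ
open import Data.Product using (∃; ∃-syntax; _×_; _,_; proj₁; proj₂)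
open import Data.Rational using (ℚ; 0ℚ; 1ℚ; _/_; _<_; _≤_; _+_; _-_; _*_; -_; 1/_; Positive; positive)
import Data.Rational.Properties as ℚ
open import Data.Sum using (_⊎_; inj₁; inj₂; swap)
open import Data.Vec using (Vec; []; _∷_; lookup; tabulate)
open import Data.Vec.Properties using (lookup∘tabulate; []=⇒lookup; lookup⇒[]=)
open import Function using (_⇔_; Injective)
open import Level using (0ℓ)
open import Relation.Binary using (Rel; Symmetric; Decidable; DecTotalOrder; tri<; tri≈; tri>)
open import Relation.Binary.Construct.Closure.ReflexiveTransitive using (Star)
open import Relation.Binary.PropositionalEquality using (_≡_; refl; sym; trans; cong; cong₂; subst; subst₂)
open import Relation.Nullary using (¬_; Dec; yes; no; does; _×-dec_; contradiction)
open import Relation.Nullary.Decidable using (dec-true)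

open import Algebra.Properties.Group ℚ.+-0-group using (⁻¹-involutive)
open import Data.List.Extrema (DecTotalOrder.totalOrder ℚ.≤-decTotalOrder) using (max; xs≤max; argmax-sel)

-- Located two-sided Dedekind cuts: L q means q < x and U q means x < q.
record ℝ : Set₁ where
  field
    L U      : ℚ → Set
    L-inh    : ∃ L
    U-inh    : ∃ U
    L-down   : ∀ {p q} → p < q → L q → L p
    U-up     : ∀ {p q} → p < q → U p → U q
    L-open   : ∀ {p} → L p → ∃[ q ] (p < q × L q)
    U-open   : ∀ {q} → U q → ∃[ p ] (p < q × U p)
    disjoint : ∀ {q} → L q → U q → ⊥
    located  : ∀ {p q} → p < q → L p ⊎ U q

  L<U : ∀ {p q} → L p → U q → p < q
  L<U {p} {q} lp uq with ℚ.<-cmp p q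
  ... | tri< p<q _ _    = p<q
  ... | tri≈ _ refl _   = ⊥-elim (disjoint lp uq)
  ... | tri> _ _ q<p    = ⊥-elim (disjoint lp (U-up q<p uq))

infix 4 _<ᴿ_

_<ᴿ_ : ℝ → ℝ → Set
x <ᴿ y = ∃[ q ] (ℝ.U x q × ℝ.L y q)

fromℚ : ℚ → ℝ
fromℚ a = record
  { L        = _< a
  ; U        = a <_
  ; L-inh    = a - 1ℚ , subst (a - 1ℚ <_) (ℚ.+-identityʳ a) (ℚ.+-monoʳ-< a (ℚ.negative⁻¹ (- 1ℚ)))
  ; U-inh    = a + 1ℚ , subst (_< a + 1ℚ) (ℚ.+-identityʳ a) (ℚ.+-monoʳ-< a (ℚ.positive⁻¹ 1ℚ))
  ; L-down   = ℚ.<-trans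
  ; U-up     = λ p<q a<p → ℚ.<-trans a<p p<q
  ; L-open   = λ p<a → let m , p<m , m<a = ℚ.<-dense p<a in m , p<m , m<a
  ; U-open   = λ a<q → let m , a<m , m<q = ℚ.<-dense a<q in m , m<q , a<m
  ; disjoint = ℚ.<-asym
  ; located  = loc
  }
  where
  loc : ∀ {p q} → p < q → p < a ⊎ a < q
  loc {p} p<q with p ℚ.<? a
  ... | yes p<a = inj₁ p<a
  ... | no  p≮a = inj₂ (ℚ.≤-<-trans (ℚ.≮⇒≥ p≮a) p<q)

fromℕℚ : ℕ → ℚ
fromℕℚ n = ℤ.+ n / 1

fromℕᴿ : ℕ → ℝ
fromℕᴿ n = fromℚ (fromℕℚ n)

private
  a-[a-u] : ∀ a u → a - (a - u) ≡ u
  a-[a-u] a u = trans (cong (a +_) (ℚ.neg-distrib-+ a (- u)))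
    (trans (sym (ℚ.+-assoc a (- a) (- - u)))
    (trans (cong₂ _+_ (ℚ.+-inverseʳ a) (⁻¹-involutive u)) (ℚ.+-identityˡ u)))

  minus-< : ∀ a {p q} → p < q → a - q < a - p
  minus-< a p<q = ℚ.+-monoʳ-< a (ℚ.neg-antimono-< p<q)

  u-b+b : ∀ u b → (u - b) + b ≡ u
  u-b+b u b = trans (ℚ.+-assoc u (- b) b) (trans (cong (λ z → u + z) (ℚ.+-inverseˡ b)) (ℚ.+-identityʳ u))

  u+b-b : ∀ u b → (u + b) - b ≡ u
  u+b-b u b = trans (ℚ.+-assoc u b (- b)) (trans (cong (λ z → u + z) (ℚ.+-inverseʳ b)) (ℚ.+-identityʳ u))

infixl 6 _ℚ-ᴿ_ _ᴿ-ℚ_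

-- a − x for rational a and real x:  q < a − x  iff  x < a − q.
_ℚ-ᴿ_ : ℚ → ℝ → ℝ
a ℚ-ᴿ x = record
  { L        = λ q → U (a - q)
  ; U        = λ q → L (a - q)
  ; L-inh    = let u , Uu = U-inh in a - u , subst U (sym (a-[a-u] a u)) Uu
  ; U-inh    = let l , Ll = L-inh in a - l , subst L (sym (a-[a-u] a l)) Ll
  ; L-down   = λ p<q → U-up (minus-< a p<q)
  ; U-up     = λ p<q → L-down (minus-< a p<q)
  ; L-open   = λ {p} Up → let u , u< , Uu = U-open Up in
                 a - u , subst (_< a - u) (a-[a-u] a p) (minus-< a u<) , subst U (sym (a-[a-u] a u)) Uu
  ; U-open   = λ {p} Lp → let l , <l , Ll = L-open Lp in
                 a - l , subst (a - l <_) (a-[a-u] a p) (minus-< a <l) , subst L (sym (a-[a-u] a l)) Ll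
  ; disjoint = λ Uq Lq → disjoint Lq Uq
  ; located  = λ p<q → swap (located (minus-< a p<q))
  }
  where open ℝ x

-- x − b for real x and rational b:  q < x − b  iff  q + b < x.
_ᴿ-ℚ_ : ℝ → ℚ → ℝ
x ᴿ-ℚ b = record
  { L        = λ q → L (q + b)
  ; U        = λ q → U (q + b)
  ; L-inh    = let l , Ll = L-inh in l - b , subst L (sym (u-b+b l b)) Ll
  ; U-inh    = let u , Uu = U-inh in u - b , subst U (sym (u-b+b u b)) Uu
  ; L-down   = λ p<q → L-down (ℚ.+-monoˡ-< b p<q)
  ; U-up     = λ p<q → U-up (ℚ.+-monoˡ-< b p<q)
  ; L-open   = λ {p} Lp → let l , <l , Ll = L-open Lp in
                 l - b , subst (_< l - b) (u+b-b p b) (ℚ.+-monoˡ-< (- b) <l) , subst L (sym (u-b+b l b)) Ll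
  ; U-open   = λ {q} Uq → let u , u< , Uu = U-open Uq in
                 u - b , subst (u - b <_) (u+b-b q b) (ℚ.+-monoˡ-< (- b) u<) , subst U (sym (u-b+b u b)) Uu
  ; disjoint = disjoint
  ; located  = λ p<q → located (ℚ.+-monoˡ-< b p<q)
  }
  where open ℝ x

private
  quot : ∀ c p → 0ℚ < p → ∃[ q ] q * p ≡ c
  quot c p 0<p = c * 1/ p , trans (ℚ.*-assoc c (1/ p) p)
      (trans (cong (c *_) (ℚ.*-inverseˡ p)) (ℚ.*-identityʳ c))
    where instance _ = ℚ.pos⇒nonZero p {{positive 0<p}}

  mulʳ-< : ∀ {r p q} → 0ℚ < r → p < q → p * r < q * r
  mulʳ-< {r} 0<r = ℚ.*-monoˡ-<-pos r {{positive 0<r}}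

  cancelʳ-< : ∀ {r p q} → 0ℚ < r → p * r < q * r → p < q
  cancelʳ-< {r} 0<r = ℚ.*-cancelʳ-<-nonNeg r {{ℚ.pos⇒nonNeg r {{positive 0<r}}}}

  nonpos-mul : ∀ {p r} → p ≤ 0ℚ → 0ℚ < r → p * r ≤ 0ℚ
  nonpos-mul {p} {r} p≤0 0<r = subst (p * r ≤_) (ℚ.*-zeroˡ r)
    (ℚ.*-monoʳ-≤-nonNeg r {{ℚ.pos⇒nonNeg r {{positive 0<r}}}} p≤0)

infixl 7 _ℚ÷ᴿ_

-- a / x for rational a > 0 and real x > 0:
-- q < a / x  iff  q u < a for some rational u > x, and
-- a / x < q  iff  a < q l for some rational 0 < l < x.
_ℚ÷ᴿ_ : (a : ℚ) .{{_ : Positive a}} (x : ℝ) → fromℚ 0ℚ <ᴿ x → ℝ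
(a ℚ÷ᴿ x) (z , 0<z , Lz) = record
  { L        = λ q → ∃[ u ] (U u × q * u < a)
  ; U        = λ q → ∃[ l ] (0ℚ < l × L l × a < q * l)
  ; L-inh    = let u , Uu = U-inh in 0ℚ , u , Uu , subst (_< a) (sym (ℚ.*-zeroˡ u)) 0<a
  ; U-inh    = let b , a<b = ℝ.U-inh (fromℚ a) ; q , qz≡b = quot b z 0<z
               in q , z , 0<z , Lz , subst (a <_) (sym qz≡b) a<b
  ; L-down   = λ p<q (u , Uu , qu<a) → u , Uu , ℚ.<-trans (mulʳ-< (0<U Uu) p<q) qu<a
  ; U-up     = λ p<q (l , 0<l , Ll , a<pl) → l , 0<l , Ll , ℚ.<-trans a<pl (mulʳ-< 0<l p<q)
  ; L-open   = λ {p} (u , Uu , pu<a) →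
                 let m , pu<m , m<a = ℚ.<-dense pu<a ; q , qu≡m = quot m u (0<U Uu)
                 in q , cancelʳ-< (0<U Uu) (subst (p * u <_) (sym qu≡m) pu<m)
                      , u , Uu , subst (_< a) (sym qu≡m) m<a
  ; U-open   = λ {q} (l , 0<l , Ll , a<ql) →
                 let m , a<m , m<ql = ℚ.<-dense a<ql ; p , pl≡m = quot m l 0<l
                 in p , cancelʳ-< 0<l (subst (_< q * l) (sym pl≡m) m<ql)
                      , l , 0<l , Ll , subst (a <_) (sym pl≡m) a<m
  ; disjoint = λ {q} → disj {q}
  ; located  = loc
  }
  where
  open ℝ x
  0<a : 0ℚ < a
  0<a = ℚ.positive⁻¹ a

  0<U : ∀ {u} → U u → 0ℚ < u
  0<U Uu = ℚ.<-trans 0<z (L<U Lz Uu)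

  disj : ∀ {q} → ∃[ u ] (U u × q * u < a) → ∃[ l ] (0ℚ < l × L l × a < q * l) → ⊥
  disj {q} (u , Uu , qu<a) (l , 0<l , Ll , a<ql) with 0ℚ ℚ.<? q
  ... | no  0≮q = ℚ.<-irrefl refl (ℚ.<-≤-trans (ℚ.<-trans 0<a a<ql) (nonpos-mul (ℚ.≮⇒≥ 0≮q) 0<l))
  ... | yes 0<q = ℚ.<-asym (ℚ.<-trans qu<a a<ql)
                    (subst₂ _<_ (ℚ.*-comm l q) (ℚ.*-comm u q) (mulʳ-< 0<q (L<U Ll Uu)))

  loc : ∀ {p q} → p < q → ∃[ u ] (U u × p * u < a) ⊎ ∃[ l ] (0ℚ < l × L l × a < q * l)
  loc {p} {q} p<q with 0ℚ ℚ.<? p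
  ... | no 0≮p = let u , Uu = U-inh in
                 inj₁ (u , Uu , ℚ.≤-<-trans (nonpos-mul (ℚ.≮⇒≥ 0≮p) (0<U Uu)) 0<a)
  ... | yes 0<p with quot a p 0<p | quot a q (ℚ.<-trans 0<p p<q)
  ...   | t , tp≡a | s , sq≡a = result (ℝ.located x r<r′)
    where
    0<q = ℚ.<-trans 0<p p<q
    0<s : 0ℚ < s
    0<s = cancelʳ-< 0<q (subst₂ _<_ (sym (ℚ.*-zeroˡ q)) (sym sq≡a) 0<a)
    s<t : s < t
    s<t = cancelʳ-< 0<p (subst (s * p <_) (trans sq≡a (sym tp≡a))
            (subst₂ _<_ (ℚ.*-comm p s) (ℚ.*-comm q s) (mulʳ-< 0<s p<q)))
    r = proj₁ (ℚ.<-dense s<t)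
    s<r = proj₁ (proj₂ (ℚ.<-dense s<t))
    r<t = proj₂ (proj₂ (ℚ.<-dense s<t))
    r′ = proj₁ (ℚ.<-dense r<t)
    r<r′ = proj₁ (proj₂ (ℚ.<-dense r<t))
    r′<t = proj₂ (proj₂ (ℚ.<-dense r<t))
    result : L r ⊎ U r′ → ∃[ u ] (U u × p * u < a) ⊎ ∃[ l ] (0ℚ < l × L l × a < q * l)
    result (inj₁ Lr)  = inj₂ (r , ℚ.<-trans 0<s s<r , Lr , subst₂ _<_ sq≡a (ℚ.*-comm r q) (mulʳ-< 0<q s<r))
    result (inj₂ Ur′) = inj₁ (r′ , Ur′ , subst₂ _<_ (ℚ.*-comm r′ p) tp≡a (mulʳ-< 0<p r′<t))

x<a⇒0<a-x : ∀ a x → x <ᴿ fromℚ a → fromℚ 0ℚ <ᴿ (a ℚ-ᴿ x)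
x<a⇒0<a-x a x (u , Uu , u<a) =
  a - u , subst (_< a - u) (ℚ.+-inverseʳ u) (ℚ.+-monoˡ-< (- u) u<a) , subst (ℝ.U x) (sym (a-[a-u] a u)) Uu

-- Simple graphs whose vertex set V is an arbitrary subset of Fin n, so that
-- subgraphs are again of this type.
record Graph (n : ℕ) : Set₁ where
  infix 4 _~_ _~?_
  field
    V        : Subset n
    _~_      : Rel (Fin n) 0ℓ
    _~?_     : Decidable _~_
    ~-sym    : Symmetric _~_
    ~-irrefl : ∀ {u} → ¬ (u ~ u)
    ~⇒∈V     : ∀ {u v} → u ~ v → u ∈ V

  edge? : (e : Fin n × Fin n) → Dec (proj₁ e Fin.< proj₂ e × proj₁ e ~ proj₂ e)
  edge? (u , v) = (u Fin.<? v) ×-dec (u ~? v)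

  -- each edge is listed once, as the pair (u , v) with u < v
  E : List (Fin n × Fin n)
  E = filter edge? (cartesianProduct (allFin n) (allFin n))

open Graph using (V; E)

infix 4 _⊆ᴳ_

_⊆ᴳ_ : ∀ {n} → Graph n → Graph n → Set
H ⊆ᴳ G = V H ⊆ˢ V G × (∀ {u v} → Graph._~_ H u v → Graph._~_ G u v)

-- The subgraph of G on V G ∩ W whose edges are those uv of G with
-- u, v ∈ W, v ∈ m u and u ∈ m v.
subgraph : ∀ {n} → Graph n → Subset n → (Fin n → Subset n) → Graph n
subgraph G W m = record
  { V        = V G ∩ W
  ; _~_      = λ u v → u ~ v × (u ∈ W × v ∈ W) × (v ∈ m u × u ∈ m v)
  ; _~?_     = λ u v → (u ~? v) ×-dec ((u ∈? W) ×-dec (v ∈? W)) ×-dec ((v ∈? m u) ×-dec (u ∈? m v))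
  ; ~-sym    = λ (e , (u∈ , v∈) , (p , q)) → ~-sym e , (v∈ , u∈) , (q , p)
  ; ~-irrefl = λ (e , _) → ~-irrefl e
  ; ~⇒∈V     = λ (e , (u∈ , _) , _) → x∈p∩q⁺ (~⇒∈V e , u∈)
  }
  where open Graph G hiding (V; E)

infix 8 _[_]

_[_] : ∀ {n} → Graph n → Subset n → Graph n
G [ W ] = record
  { V        = V G ∩ W
  ; _~_      = λ u v → u ~ v × u ∈ W × v ∈ W
  ; _~?_     = λ u v → (u ~? v) ×-dec (u ∈? W) ×-dec (v ∈? W)
  ; ~-sym    = λ (e , u∈ , v∈) → ~-sym e , v∈ , u∈
  ; ~-irrefl = λ (e , _) → ~-irrefl e
  ; ~⇒∈V     = λ (e , u∈ , _) → x∈p∩q⁺ (~⇒∈V e , u∈)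
  }
  where open Graph G hiding (V; E)

nonempty⇒∣∣≢0 : ∀ {n} {p : Subset n} → Nonempty p → NonZero ∣ p ∣
nonempty⇒∣∣≢0 {p = p} (x , x∈p) = ℕ.>-nonZero (subst (ℕ._≤ ∣ p ∣) (∣⁅x⁆∣≡1 x)
  (p⊆q⇒∣p∣≤∣q∣ (λ y∈ → subst (_∈ p) (sym (x∈⁅y⁆⇒x≡y x y∈)) x∈p)))

avgDegree : ∀ {n} (H : Graph n) → Nonempty (V H) → ℚ
avgDegree H ne = _/_ (ℤ.+ (2 ℕ.* length (E H))) ∣ V H ∣ {{nonempty⇒∣∣≢0 ne}}

avgDegreeIf : ∀ {n} (H : Graph n) → Dec (Nonempty (V H)) → Maybe ℚ
avgDegreeIf H (yes ne) = just (avgDegree H ne)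
avgDegreeIf H (no  _)  = nothing

avgDegree? : ∀ {n} → Graph n → Maybe ℚ
avgDegree? H = avgDegreeIf H (nonempty? (V H))

allVecs : ∀ {A : Set} → List A → ∀ n → List (Vec A n)
allVecs xs zero    = [] ∷ []
allVecs xs (suc n) = cartesianProductWith _∷_ xs (allVecs xs n)

subsets : ∀ n → List (Subset n)
subsets = allVecs (true ∷ false ∷ [])

subgraphs : ∀ {n} → Graph n → List (Graph n)
subgraphs {n} G = cartesianProductWith (λ W m → subgraph G W (lookup m)) (subsets n) (allVecs (subsets n) n)

-- The base value 0 only matters for the graph without vertices, where the
-- maximum is over the empty set; see mad-upper and mad-attained.
mad : ∀ {n} → Graph n → ℚ
mad G = max 0ℚ (mapMaybe avgDegree? (subgraphs G))

private
  ∈-mapMaybe⁺ : ∀ {a} {A : Set a} {B : Set} (f : A → Maybe B) {xs x y} →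
                x List.∈ xs → f x ≡ just y → y List.∈ mapMaybe f xs
  ∈-mapMaybe⁺ f (here refl) eq rewrite eq = here refl
  ∈-mapMaybe⁺ f {x′ ∷ _} (there x∈) eq with f x′
  ... | just _  = there (∈-mapMaybe⁺ f x∈ eq)
  ... | nothing = ∈-mapMaybe⁺ f x∈ eq

  ∈-mapMaybe⁻ : ∀ {a} {A : Set a} {B : Set} (f : A → Maybe B) {xs y} →
                y List.∈ mapMaybe f xs → ∃[ x ] (x List.∈ xs × f x ≡ just y)
  ∈-mapMaybe⁻ f {x ∷ xs} y∈ with f x in eq
  ∈-mapMaybe⁻ f {x ∷ xs} (here refl) | just _ = x , here refl , eq
  ∈-mapMaybe⁻ f {x ∷ xs} (there y∈)  | just _ = let z , z∈ , e = ∈-mapMaybe⁻ f y∈ in z , there z∈ , e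
  ∈-mapMaybe⁻ f {x ∷ xs} y∈          | nothing = let z , z∈ , e = ∈-mapMaybe⁻ f y∈ in z , there z∈ , e

∈-allVecs : ∀ {A : Set} {xs : List A} → (∀ x → x List.∈ xs) → ∀ {n} (v : Vec A n) → v List.∈ allVecs xs n
∈-allVecs all []      = here refl
∈-allVecs all (x ∷ v) = ∈-cartesianProductWith⁺ _∷_ (all x) (∈-allVecs all v)

∈-subsets : ∀ {n} (p : Subset n) → p List.∈ subsets n
∈-subsets = ∈-allVecs λ { true → here refl ; false → there (here refl) }

private
  avgDegreeIf-just : ∀ {n} (H : Graph n) (ne? : Dec (Nonempty (V H))) → Nonempty (V H) →
                     ∃[ ne ] avgDegreeIf H ne? ≡ just (avgDegree H ne)
  avgDegreeIf-just H (yes ne) _  = ne , refl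
  avgDegreeIf-just H (no ¬ne) ne = contradiction ne ¬ne

  avgDegreeIf-sound : ∀ {n} (H : Graph n) (ne? : Dec (Nonempty (V H))) {q} → avgDegreeIf H ne? ≡ just q →
                      ∃[ ne ] avgDegree H ne ≡ q
  avgDegreeIf-sound H (yes ne) refl = ne , refl

avgDegree-cong : ∀ {n} (H K : Graph n) (neH : Nonempty (V H)) (neK : Nonempty (V K)) → H ⊆ᴳ K → K ⊆ᴳ H →
                 avgDegree H neH ≡ avgDegree K neK
avgDegree-cong {n} H K neH neK (V⊆ , ~⊆) (V⊇ , ~⊇) =
  ℚ./-cong {{nonempty⇒∣∣≢0 neH}} {{nonempty⇒∣∣≢0 neK}}
    (cong (λ es → ℤ.+ (2 ℕ.* length es)) (filter-≐ (Graph.edge? H) (Graph.edge? K)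
      ((λ (lt , e) → lt , ~⊆ e) , (λ (lt , e) → lt , ~⊇ e)) (cartesianProduct (allFin n) (allFin n))))
    (cong ∣_∣ (⊆-antisym V⊆ V⊇))

subgraph⊆ : ∀ {n} (G : Graph n) W m → subgraph G W m ⊆ᴳ G
subgraph⊆ G W m = p∩q⊆p (V G) W , proj₁

mad-upper : ∀ {n} (G H : Graph n) → H ⊆ᴳ G → (ne : Nonempty (V H)) → avgDegree H ne ≤ mad G
mad-upper {n} G H (V⊆ , ~⊆) ne = 
  let neK , eq = avgDegreeIf-just K (nonempty? (V K)) (proj₁ ne , proj₁ H⊆K (proj₂ ne)) in
  subst (_≤ mad G) (avgDegree-cong K H neK ne K⊆H H⊆K)
    (All.lookup (xs≤max 0ℚ _) (∈-mapMaybe⁺ avgDegree? K∈ eq))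
  where
  row : Fin n → Subset n
  row u = tabulate (λ v → does (Graph._~?_ H u v))
  M : Vec (Subset n) n
  M = tabulate row
  K = subgraph G (V H) (lookup M)
  K∈ : K List.∈ subgraphs G
  K∈ = ∈-cartesianProductWith⁺ _ (∈-subsets (V H)) (∈-allVecs ∈-subsets M)

  to : ∀ {u v} → Graph._~_ H u v → v ∈ lookup M u
  to {u} {v} e = subst (v ∈_) (sym (lookup∘tabulate row u))
    (lookup⇒[]= v (row u) (trans (lookup∘tabulate _ v) (dec-true (Graph._~?_ H u v) e)))

  from : ∀ {u v} → v ∈ lookup M u → Graph._~_ H u v
  from {u} {v} v∈ with Graph._~?_ H u v in eq
  ... | yes e = e
  ... | no  _ = contradiction
      (trans (sym (cong does eq)) (trans (sym (lookup∘tabulate _ v))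
        ([]=⇒lookup (subst (v ∈_) (lookup∘tabulate row u) v∈)))) λ ()

  H⊆K : H ⊆ᴳ K
  H⊆K = (λ x∈ → x∈p∩q⁺ (V⊆ x∈ , x∈))
      , (λ e → ~⊆ e , (Graph.~⇒∈V H e , Graph.~⇒∈V H (Graph.~-sym H e)) , (to e , to (Graph.~-sym H e)))
  K⊆H : K ⊆ᴳ H
  K⊆H = p∩q⊆q (V G) (V H) , (λ (_ , _ , (p , _)) → from p)

mad-attained : ∀ {n} (G : Graph n) → Nonempty (V G) →
               ∃[ H ] (H ⊆ᴳ G × ∃[ ne ] avgDegree H ne ≡ mad G)
mad-attained {n} G neG = attained (argmax-sel (λ q → q) 0ℚ (mapMaybe avgDegree? (subgraphs G)))
  where
  Attained : ℚ → Set₁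
  Attained q = ∃[ H ] (H ⊆ᴳ G × ∃[ ne ] avgDegree H ne ≡ q)

  G⊆G : G ⊆ᴳ G
  G⊆G = (λ x → x) , (λ e → e)

  0≤ : 0ℚ ≤ avgDegree G neG
  0≤ = ℚ.nonNegative⁻¹ _ {{ℚ.normalize-nonNeg (2 ℕ.* length (E G)) ∣ V G ∣ {{nonempty⇒∣∣≢0 neG}}}}

  listed : ∀ {q} → ∃[ H ] (H List.∈ subgraphs G × avgDegree? H ≡ just q) → Attained q
  listed (H , H∈ , eq) =
    let W , m , _ , _ , H≡ = ∈-cartesianProductWith⁻ (λ W m → subgraph G W (lookup m))
                               (subsets n) (allVecs (subsets n) n) H∈
    in H , subst (_⊆ᴳ G) (sym H≡) (subgraph⊆ G W (lookup m)) , avgDegreeIf-sound H (nonempty? (V H)) eq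

  attained : mad G ≡ 0ℚ ⊎ mad G List.∈ mapMaybe avgDegree? (subgraphs G) → Attained (mad G)
  attained (inj₁ mad≡0) = G , G⊆G , neG ,
    ℚ.≤-antisym (mad-upper G G G⊆G neG) (subst (_≤ avgDegree G neG) (sym mad≡0) 0≤)
  attained (inj₂ mad∈)  = listed (∈-mapMaybe⁻ avgDegree? mad∈)

Independent : ∀ {n} → Graph n → Subset n → Set
Independent G A = ∀ {u v} → u ∈ A → v ∈ A → ¬ (Graph._~_ G u v)

-- a cycle c₀ c₁ … c₍ₖ₊₂₎ c₀ of length k + 3
record Cycle {n} (G : Graph n) : Set where
  open Graph G using (_~_)
  field
    {k}    : ℕ
    c      : Fin (3 ℕ.+ k) → Fin n
    c-inj  : Injective _≡_ _≡_ c
    step   : ∀ (i : Fin (2 ℕ.+ k)) → c (inject₁ i) ~ c (suc i)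
    closed : c (fromℕ (2 ℕ.+ k)) ~ c zero

Forest : ∀ {n} → Graph n → Set
Forest G = ¬ Cycle G

-- C is exactly the set of vertices joined by a path to some v ∈ V G.
IsComponent : ∀ {n} → Graph n → Subset n → Set
IsComponent G C = ∃[ v ] (v ∈ V G × ∀ u → u ∈ C ⇔ Star (Graph._~_ G) v u)

-- either part may be empty
IsPartition : ∀ {n} → Subset n → Subset n → Subset n → Set
IsPartition S A B = A ∪ B ≡ S × Empty (A ∩ B)

{-# OPTIONS --safe #-}

-- Let N = d + 2 and, for a set T of vertices, Φ κ T = Σ_{v ∈ T} κ v − 2N e(T).
-- For κ = 2N − 2 the hypothesis on mad reads Φ κ T + N|T| > 0 for all nonempty T,
-- whereas Φ κ T > 0 for all nonempty T ⊆ B makes G[B] a forest whose components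
-- have fewer than N vertices, because Φ κ C ≤ 2N − 2|C| for connected C.
--
-- So it suffices to show, for U ⊆ V and κ ≤ 2N: if Φ κ T + N|T ∩ U| > 0 for all
-- nonempty T ⊆ V, then Φ κ T > 0 for all nonempty T ⊆ V ∖ I and some independent
-- I ⊆ U. Here U is the set of undecided vertices; those of V ∖ U are already in B.
-- Induct on |V| + |U|. Averaging over V gives a vertex u of degree at most 1, or an
-- undecided u of degree 2 with κ u > N. Delete u and lower κ by 2N − κ u at its
-- neighbours (not needed if u is undecided of degree at most 1); afterwards u goes to
-- I if it is undecided and has no neighbour in I, and to B otherwise.
-- This is blocked only by sets S that contain a neighbour x of u, avoid u, and have
-- small potential. Take S of minimum potential δ. If S has no undecided vertex, u can
-- be put in I. Otherwise decide S first, with κ x lowered by δ − 1, and then the rest: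
-- lowering κ x guarantees that the part of S in B keeps potential at least δ when it
-- contains x, so nothing is lost when u and the rest of V ∖ S are added to it.

module Submission where

module Extension where
  open import Defs
  open import Data.Bool using (Bool; true; false; _∧_; _∨_; not)
  open import Data.Bool.Properties using (¬-not)
  open import Data.Fin as Fin using (Fin; zero; suc; _≟_; inject₁; fromℕ; toℕ)
  import Data.Fin.Properties as Fin
  open import Data.Fin.Relation.Unary.Top using (view; ‵fromℕ; ‵inject₁)
  import Data.Fin.Subset as Subset
  import Data.Fin.Subset.Properties as Subset
  open import Data.Integer as ℤ
    using (ℤ; 0ℤ; 1ℤ; +_; -_; _+_; _*_; _-_; _<_; _≤_; +≤+; +<+; nonNegative; positive)
  open import Data.Integer.Properties as ℤ using (module ≤-Reasoning)
  open import Data.Integer.Tactic.RingSolver using (solve-∀)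
  open import Data.List as List using (List; []; _∷_; length; filter; allFin; cartesianProduct; map; _++_)
  open import Data.Nat as ℕ using (ℕ; zero; suc; z≤n; s≤s)
  import Data.Nat.Properties as ℕ
  open import Data.Product using (∃; ∃-syntax; _×_; _,_; proj₁; proj₂)
  open import Data.Rational as ℚ using (ℚ; 0ℚ; toℚᵘ)
  import Data.Rational.Properties as ℚ
  open import Data.Rational.Solver using () renaming (module +-*-Solver to ℚ-Solver)
  open import Data.Rational.Unnormalised as ℚᵘ using (mkℚᵘ; *≡*; *<*)
  import Data.Rational.Unnormalised.Properties as ℚᵘ
  open import Data.Sum using (_⊎_; inj₁; inj₂; [_,_]′)
  open import Data.Vec using ([]; _∷_; lookup; tabulate)
  open import Data.Vec.Properties using (lookup∘tabulate; []=⇒lookup; lookup⇒[]=)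
  open import Function using (_∘_; id; Equivalence)
  open import Relation.Binary using (tri<; tri≈; tri>)
  open import Relation.Binary.Construct.Closure.ReflexiveTransitive using (Star; ε; _◅_; _◅◅_)
  open import Relation.Binary.PropositionalEquality
    using (_≡_; _≢_; refl; sym; trans; cong; cong₂; subst; subst₂; module ≡-Reasoning)
  open import Relation.Nullary using (¬_; Dec; yes; no; does; contradiction)
  open import Relation.Nullary.Decidable using (dec-true; dec-false; map′; _→-dec_; _×-dec_)

  open import Algebra.Properties.Semiring.Sum ℤ.+-*-semiring
    using (sum; sum-cong-≗; ∑-distrib-+; ∑-comm; *-distribˡ-sum)

  -- Sums and inequalities over the integers

  sum-nonneg : ∀ {n} {f : Fin n → ℤ} → (∀ i → 0ℤ ≤ f i) → 0ℤ ≤ sum f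
  sum-nonneg {zero}  _   = ℤ.≤-refl
  sum-nonneg {suc _} f≥0 = ℤ.+-mono-≤ (f≥0 zero) (sum-nonneg (f≥0 ∘ suc))

  sum-zero : ∀ {n} {f : Fin n → ℤ} → (∀ i → f i ≡ 0ℤ) → sum f ≡ 0ℤ
  sum-zero {zero}  _  = refl
  sum-zero {suc _} f≡0 = cong₂ _+_ (f≡0 zero) (sum-zero (f≡0 ∘ suc))

  sum-pos⇒∃ : ∀ {n} {f : Fin n → ℤ} → 0ℤ < sum f → ∃[ i ] 0ℤ < f i
  sum-pos⇒∃ {zero} (+<+ ())
  sum-pos⇒∃ {suc _} {f} 0<Σ with 0ℤ ℤ.<? f zero
  ... | yes 0<f = zero , 0<f
  ... | no  0≮f =
    let i , p = sum-pos⇒∃ {f = f ∘ suc} (ℤ.<-≤-trans 0<Σ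
          (subst (sum f ≤_) (ℤ.+-identityˡ (sum (f ∘ suc)))
            (ℤ.+-monoˡ-≤ (sum (f ∘ suc)) (ℤ.≮⇒≥ 0≮f))))
    in suc i , p

  0≤* : ∀ {a b} → 0ℤ ≤ a → 0ℤ ≤ b → 0ℤ ≤ a * b
  0≤* {a} {b} 0≤a 0≤b = subst (_≤ a * b) (ℤ.*-zeroʳ a)
    (ℤ.*-monoˡ-≤-nonNeg a {{nonNegative 0≤a}} 0≤b)

  0<* : ∀ {a b} → 0ℤ < a → 0ℤ < b → 0ℤ < a * b
  0<* {a} {b} 0<a 0<b = subst (_< a * b) (ℤ.*-zeroʳ a) (ℤ.*-monoˡ-<-pos a {{positive 0<a}} 0<b)

  0≤⇒≤ : ∀ {a b} → 0ℤ ≤ b - a → a ≤ b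
  0≤⇒≤ = ℤ.0≤i-j⇒j≤i

  ≤⇒0≤ : ∀ {a b} → a ≤ b → 0ℤ ≤ b - a
  ≤⇒0≤ = ℤ.i≤j⇒0≤j-i

  <⇒0< : ∀ {a b} → a < b → 0ℤ < b - a
  <⇒0< {a} {b} a<b = subst (_< b - a) (ℤ.+-inverseʳ a) (ℤ.+-monoˡ-< (- a) a<b)

  0<⇒< : ∀ {a b} → 0ℤ < b - a → a < b
  0<⇒< {a} {b} 0<d = subst₂ _<_ (ℤ.+-identityˡ a) (lemma b a) (ℤ.+-monoˡ-< a 0<d)
    where
    lemma : ∀ b a → b - a + a ≡ b
    lemma = solve-∀

  -- Integrality turns a strict inequality into a gain of 1. The equation is a separate argument so
  -- that the ring solver can supply it.
  0<⇒0≤-1 : ∀ {a b} → b ≡ a - 1ℤ → 0ℤ < a → 0ℤ ≤ b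
  0<⇒0≤-1 {+ suc k} refl (+<+ _) = +≤+ z≤n

  does⇒ : ∀ {P : Set} (P? : Dec P) → does P? ≡ true → P
  does⇒ (yes p) _ = p

  𝟙 : Bool → ℤ
  𝟙 true  = 1ℤ
  𝟙 false = 0ℤ

  0≤𝟙 : ∀ b → 0ℤ ≤ 𝟙 b
  0≤𝟙 true  = +≤+ z≤n
  0≤𝟙 false = +≤+ z≤n

  0<-resp : ∀ {a b} → a ≡ b → 0ℤ < b → 0ℤ < a
  0<-resp refl p = p

  0≤-resp : ∀ {a b} → a ≡ b → 0ℤ ≤ b → 0ℤ ≤ a
  0≤-resp refl p = p

  0<+ : ∀ {a b} → 0ℤ < a → 0ℤ ≤ b → 0ℤ < a + b
  0<+ = ℤ.+-mono-<-≤

  0≤+ : ∀ {a b} → 0ℤ ≤ a → 0ℤ ≤ b → 0ℤ ≤ a + b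
  0≤+ = ℤ.+-mono-≤

  ≤1⇒≡ : ∀ {t} → 0ℤ ≤ t → t ≤ 1ℤ → t ≡ 0ℤ ⊎ t ≡ 1ℤ
  ≤1⇒≡ {+ 0} _ _ = inj₁ refl
  ≤1⇒≡ {+ 1} _ _ = inj₂ refl
  ≤1⇒≡ {+ suc (suc _)} _ (+≤+ (s≤s ()))

  ≤2⇒≡ : ∀ {t} → 0ℤ ≤ t → t ≤ + 2 → (t ≡ 0ℤ ⊎ t ≡ 1ℤ) ⊎ t ≡ + 2
  ≤2⇒≡ {+ 0} _ _ = inj₁ (inj₁ refl)
  ≤2⇒≡ {+ 1} _ _ = inj₁ (inj₂ refl)
  ≤2⇒≡ {+ 2} _ _ = inj₂ refl
  ≤2⇒≡ {+ suc (suc (suc _))} _ (+≤+ (s≤s (s≤s ())))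

  -- The predecessor and the successor on the cycle are distinct because the length is at least 3.
  -- The first and last positions are separate cases, as one of their neighbours comes from the
  -- closing edge.
  cyclic-neighbours : ∀ {k} {A : Set} (R : A → A → Set) → (∀ {a b} → R a b → R b a) →
    (c : Fin (3 ℕ.+ k) → A) → (∀ i → R (c (inject₁ i)) (c (suc i))) →
    R (c (fromℕ (2 ℕ.+ k))) (c zero) →
    ∀ i → ∃[ p ] ∃[ q ] p ≢ q × R (c i) (c p) × R (c i) (c q)
  cyclic-neighbours R R-sym c step closed zero =
    suc zero , fromℕ _ , (λ ()) , step zero , R-sym closed
  cyclic-neighbours {k} R R-sym c step closed (suc j) with suc j in eq | view (suc j)
  ... | _ | ‵fromℕ =
    inject₁ j , zero , prev≢zero j eq , R-sym
      (subst (λ i → R (c (inject₁ j)) (c i)) eq (step j)) , closed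
    where
    prev≢zero : ∀ j → suc j ≡ fromℕ (2 ℕ.+ k) → inject₁ j ≢ zero
    prev≢zero zero ()
    prev≢zero (suc _) _ ()
  ... | _ | ‵inject₁ i =
    inject₁ j , suc i , prev≢next , R-sym (subst (λ i → R (c (inject₁ j)) (c i)) eq (step j)) ,
      step i
    where
    prev≢next : inject₁ j ≢ suc i
    prev≢next e = ℕ.<-irrefl
      (trans (sym (Fin.toℕ-inject₁ j))
        (trans (cong toℕ e) (cong suc (trans (sym (Fin.toℕ-inject₁ i)) (sym (cong toℕ eq))))))
      (ℕ.m≤n⇒m≤1+n ℕ.≤-refl)

  -- Sums over vertex sets

  module Sets (n : ℕ) where

    Sub : Set
    Sub = Fin n → Bool

    infix 4 _∈_ _∉_ _∈?_ _⊆_ _≐_⊎_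
    infixl 6 _∖_ _∪_
    infixl 7 _∩_

    -- Wrapping the Boolean equation in a record lets unification recover both `v` and `S` from the
    -- type.
    record _∈_ (v : Fin n) (S : Sub) : Set where
      constructor mem
      field holds : S v ≡ true

    _∉_ : Fin n → Sub → Set
    v ∉ S = ¬ v ∈ S

    _∈?_ : ∀ v S → Dec (v ∈ S)
    v ∈? S with S v in eq
    ... | true  = yes (mem eq)
    ... | false = no λ (mem eq′) → contradiction (trans (sym eq′) eq) λ ()

    _⊆_ : Sub → Sub → Set
    S ⊆ T = ∀ {v} → v ∈ S → v ∈ T

    Nonempty : Sub → Set
    Nonempty S = ∃[ v ] v ∈ S

    nonempty? : ∀ T → Dec (Nonempty T)
    nonempty? T = Fin.any? λ v → v ∈? T

    -- Disjoint union in the form that sums consume. Additivity of the indicators forces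
    -- disjointness, since an indicator is at most 1.
    record _≐_⊎_ (T P Q : Sub) : Set where
      constructor split
      field 𝟙-+ : ∀ v → 𝟙 (T v) ≡ 𝟙 (P v) + 𝟙 (Q v)

    ∈⇒𝟙≡1 : ∀ {v S} → v ∈ S → 𝟙 (S v) ≡ 1ℤ
    ∈⇒𝟙≡1 (mem eq) = cong 𝟙 eq

    ∉⇒𝟙≡0 : ∀ {v S} → v ∉ S → 𝟙 (S v) ≡ 0ℤ
    ∉⇒𝟙≡0 {v} {S} v∉S with S v in eq
    ... | true  = contradiction (mem eq) v∉S
    ... | false = refl

    ∉⇒≡false : ∀ {v S} → v ∉ S → S v ≡ false
    ∉⇒≡false v∉S = ¬-not (v∉S ∘ mem)

    0<𝟙⇒∈ : ∀ {v S} → 0ℤ < 𝟙 (S v) → v ∈ S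
    0<𝟙⇒∈ {v} {S} 0<𝟙 with v ∈? S
    ... | yes v∈S = v∈S
    ... | no  v∉S = contradiction (subst (0ℤ <_) (∉⇒𝟙≡0 v∉S) 0<𝟙) (ℤ.<-irrefl refl)

    opaque
      _∪_ _∩_ _∖_ : Sub → Sub → Sub
      (S ∪ T) v = S v ∨ T v
      (S ∩ T) v = S v ∧ T v
      (S ∖ T) v = S v ∧ not (T v)

      ⁅_⁆ : Fin n → Sub
      ⁅ u ⁆ v = does (u ≟ v)

      ∈∖⁺ : ∀ {S T v} → v ∈ S → v ∉ T → v ∈ S ∖ T
      ∈∖⁺ (mem s) v∉T = mem (cong₂ (λ a b → a ∧ not b) s (¬-not (v∉T ∘ mem)))

      ∈∖⁻ : ∀ {S T v} → v ∈ S ∖ T → v ∈ S × v ∉ T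
      ∈∖⁻ {S} {T} {v} (mem eq) with S v in s | T v in t
      ... | true | false = mem s , λ (mem t′) → contradiction (trans (sym t′) t) λ ()

      ∈∩⁺ : ∀ {S T v} → v ∈ S → v ∈ T → v ∈ S ∩ T
      ∈∩⁺ (mem s) (mem t) = mem (cong₂ _∧_ s t)

      ∈∩⁻ : ∀ {S T v} → v ∈ S ∩ T → v ∈ S × v ∈ T
      ∈∩⁻ {S} {T} {v} (mem eq) with S v in s | T v in t
      ... | true | true = mem s , mem t

      ∈∪⁻ : ∀ {S T v} → v ∈ S ∪ T → v ∈ S ⊎ v ∈ T
      ∈∪⁻ {S} {T} {v} (mem eq) with S v in s
      ... | true  = inj₁ (mem s)
      ... | false = inj₂ (mem eq)

      ∈∪⁺ˡ : ∀ {S T v} → v ∈ S → v ∈ S ∪ T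
      ∈∪⁺ˡ {S} {T} {v} (mem s) = mem (cong (_∨ T v) s)

      ∈∪⁺ʳ : ∀ {S T v} → v ∈ T → v ∈ S ∪ T
      ∈∪⁺ʳ {S} {T} {v} (mem t) with S v in s
      ... | true  = mem (cong (_∨ T v) s)
      ... | false = mem (trans (cong (_∨ T v) s) t)

      u∈⁅u⁆ : ∀ {u} → u ∈ ⁅ u ⁆
      u∈⁅u⁆ {u} = mem (dec-true (u ≟ u) refl)

      ∈⁅⁆⁻ : ∀ {u v} → v ∈ ⁅ u ⁆ → u ≡ v
      ∈⁅⁆⁻ {u} {v} (mem eq) with u ≟ v
      ... | yes u≡v = u≡v

      ∪-≐ : ∀ {P Q} → (∀ {v} → v ∈ P → v ∉ Q) → P ∪ Q ≐ P ⊎ Q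
      ∪-≐ {P} {Q} disj = split eq
        where
        eq : ∀ v → 𝟙 (P v ∨ Q v) ≡ 𝟙 (P v) + 𝟙 (Q v)
        eq v with P v in p | Q v in q
        ... | true  | true  = contradiction (mem q) (disj (mem p))
        ... | true  | false = refl
        ... | false | true  = refl
        ... | false | false = refl

      ∩∖-≐ : ∀ T S → T ≐ T ∩ S ⊎ T ∖ S
      ∩∖-≐ T S = split eq
        where
        eq : ∀ v → 𝟙 (T v) ≡ 𝟙 (T v ∧ S v) + 𝟙 (T v ∧ not (S v))
        eq v with S v | T v
        ... | true  | true  = refl
        ... | true  | false = refl
        ... | false | true  = refl
        ... | false | false = refl

      ∖-≐ : ∀ {S T} → S ⊆ T → T ≐ S ⊎ T ∖ S
      ∖-≐ {S} {T} S⊆T = split eq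
        where
        eq : ∀ v → 𝟙 (T v) ≡ 𝟙 (S v) + 𝟙 (T v ∧ not (S v))
        eq v with S v in s | T v in t
        ... | true  | true  = refl
        ... | true  | false = contradiction (trans (sym (_∈_.holds (S⊆T (mem s)))) t) λ ()
        ... | false | true  = refl
        ... | false | false = refl

    ∈⇒⁅⁆⊆ : ∀ {T u} → u ∈ T → ⁅ u ⁆ ⊆ T
    ∈⇒⁅⁆⊆ {T} u∈T v∈ = subst (_∈ T) (∈⁅⁆⁻ v∈) u∈T

    remove-≐ : ∀ {T u} → u ∈ T → T ≐ ⁅ u ⁆ ⊎ T ∖ ⁅ u ⁆
    remove-≐ u∈T = ∖-≐ (∈⇒⁅⁆⊆ u∈T)

    insert-≐ : ∀ {T u} → u ∉ T → ⁅ u ⁆ ∪ T ≐ ⁅ u ⁆ ⊎ T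
    insert-≐ {T} u∉T = ∪-≐ λ v∈ v∈T → u∉T (subst (_∈ T) (sym (∈⁅⁆⁻ v∈)) v∈T)

    opaque
      unfolding ⁅_⁆

      -- Sizes, degrees, edge counts and potentials are all built from this one weighted sum, so
      -- additivity over disjoint unions is proved only once.
      lin : (Fin n → ℤ) → Sub → ℤ
      lin c T = sum λ v → 𝟙 (T v) * c v

      lin-≐ : ∀ c {T P Q} → T ≐ P ⊎ Q → lin c T ≡ lin c P + lin c Q
      lin-≐ c {T} {P} {Q} (split T≐) = trans
        (sum-cong-≗ λ v → trans (cong (_* c v) (T≐ v)) (ℤ.*-distribʳ-+ (c v) (𝟙 (P v)) (𝟙 (Q v))))
        (∑-distrib-+ (λ v → 𝟙 (P v) * c v) (λ v → 𝟙 (Q v) * c v))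

      lin-nonneg : ∀ {c T} → (∀ {v} → v ∈ T → 0ℤ ≤ c v) → 0ℤ ≤ lin c T
      lin-nonneg {c} {T} h = sum-nonneg λ v → 0≤term v
        where
        0≤term : ∀ v → 0ℤ ≤ 𝟙 (T v) * c v
        0≤term v with T v in eq
        ... | true  = subst (0ℤ ≤_) (sym (ℤ.*-identityˡ (c v))) (h (mem eq))
        ... | false = ℤ.≤-refl

      lin-+* : ∀ c k c′ T → lin (λ v → c v + k * c′ v) T ≡ lin c T + k * lin c′ T
      lin-+* c k c′ T = begin
        sum (λ v → 𝟙 (T v) * (c v + k * c′ v))
          ≡⟨ sum-cong-≗ (λ v → lemma (𝟙 (T v)) (c v) k (c′ v)) ⟩
        sum (λ v → 𝟙 (T v) * c v + k * (𝟙 (T v) * c′ v))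
          ≡⟨ ∑-distrib-+ (λ v → 𝟙 (T v) * c v) (λ v → k * (𝟙 (T v) * c′ v)) ⟩
        lin c T + sum (λ v → k * (𝟙 (T v) * c′ v))
          ≡⟨ cong (λ z → lin c T + z) (*-distribˡ-sum k (λ v → 𝟙 (T v) * c′ v)) ⟨
        lin c T + k * lin c′ T ∎
        where
        open ≡-Reasoning
        lemma : ∀ t c k c′ → t * (c + k * c′) ≡ t * c + k * (t * c′)
        lemma = solve-∀

      lin-≡ : ∀ {c c′ T} → (∀ {v} → v ∈ T → c v ≡ c′ v) → lin c T ≡ lin c′ T
      lin-≡ {c} {c′} {T} h = sum-cong-≗ eq
        where
        eq : ∀ v → 𝟙 (T v) * c v ≡ 𝟙 (T v) * c′ v
        eq v with T v in e
        ... | true  = cong (1ℤ *_) (h (mem e))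
        ... | false = refl

      lin-⁅⁆ : ∀ c u → lin c ⁅ u ⁆ ≡ c u
      lin-⁅⁆ c u = go c u
        where
        go : ∀ {m} (c : Fin m → ℤ) u → sum (λ v → 𝟙 (does (u ≟ v)) * c v) ≡ c u
        go c zero    = trans (cong₂ _+_ (ℤ.*-identityˡ (c zero))
          (sum-zero {f = λ v → 0ℤ * c (suc v)} λ i → refl)) (ℤ.+-identityʳ (c zero))
        go c (suc u) = trans (ℤ.+-identityˡ (sum λ v → 𝟙 (does (u ≟ v)) * c (suc v)))
          (go (c ∘ suc) u)

      lin-swap : ∀ (b : Fin n → Fin n → ℤ) S T →
                 lin (λ u → lin (b u) T) S ≡ lin (λ v → lin (λ u → b u v) S) T
      lin-swap b S T = begin
        sum (λ u → 𝟙 (S u) * sum (λ v → 𝟙 (T v) * b u v))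
          ≡⟨ sum-cong-≗ (λ u → *-distribˡ-sum (𝟙 (S u)) (λ v → 𝟙 (T v) * b u v)) ⟩
        sum (λ u → sum (λ v → 𝟙 (S u) * (𝟙 (T v) * b u v)))
          ≡⟨ ∑-comm (λ u v → 𝟙 (S u) * (𝟙 (T v) * b u v)) ⟩
        sum (λ v → sum (λ u → 𝟙 (S u) * (𝟙 (T v) * b u v)))
          ≡⟨ sum-cong-≗ (λ v → sum-cong-≗ λ u → lemma (𝟙 (S u)) (𝟙 (T v)) (b u v)) ⟩
        sum (λ v → sum (λ u → 𝟙 (T v) * (𝟙 (S u) * b u v)))
          ≡⟨ sum-cong-≗ (λ v → *-distribˡ-sum (𝟙 (T v)) (λ u → 𝟙 (S u) * b u v)) ⟨
        sum (λ v → 𝟙 (T v) * sum (λ u → 𝟙 (S u) * b u v)) ∎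
        where
        open ≡-Reasoning
        lemma : ∀ s t b → s * (t * b) ≡ t * (s * b)
        lemma = solve-∀

      lin-cong : ∀ c {S T} → (∀ v → S v ≡ T v) → lin c S ≡ lin c T
      lin-cong c S≗T = sum-cong-≗ λ v → cong (λ b → 𝟙 b * c v) (S≗T v)

      lin-empty : ∀ c {T} → ¬ Nonempty T → lin c T ≡ 0ℤ
      lin-empty c {T} ∅ = sum-zero term≡0
        where
        term≡0 : ∀ v → 𝟙 (T v) * c v ≡ 0ℤ
        term≡0 v with T v in eq
        ... | true  = contradiction (v , mem eq) ∅
        ... | false = refl

      count-sym : ∀ S T → lin (𝟙 ∘ S) T ≡ lin (𝟙 ∘ T) S
      count-sym S T = sum-cong-≗ λ v → ℤ.*-comm (𝟙 (T v)) (𝟙 (S v))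

      lin-0 : ∀ T → lin (λ _ → 0ℤ) T ≡ 0ℤ
      lin-0 T = sum-zero λ v → ℤ.*-zeroʳ (𝟙 (T v))

      lin-+ : ∀ c c′ T → lin (λ v → c v + c′ v) T ≡ lin c T + lin c′ T
      lin-+ c c′ T = trans (sum-cong-≗ λ v → ℤ.*-distribˡ-+ (𝟙 (T v)) (c v) (c′ v))
        (∑-distrib-+ (λ v → 𝟙 (T v) * c v) (λ v → 𝟙 (T v) * c′ v))

      lin-pos⇒∃ : ∀ {c T} → 0ℤ < lin c T → ∃[ v ] v ∈ T × 0ℤ < c v
      lin-pos⇒∃ {c} {T} 0<lin with sum-pos⇒∃ 0<lin
      ... | v , p with T v in eq
      ...   | true  = v , mem eq , subst (0ℤ <_) (ℤ.*-identityˡ (c v)) p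
      ...   | false = contradiction p (λ { (+<+ ()) })

    size : Sub → ℤ
    size = lin λ _ → 1ℤ

    lin-mono : ∀ {c c′ T} → (∀ {v} → v ∈ T → c v ≤ c′ v) → lin c T ≤ lin c′ T
    lin-mono {c} {c′} {T} c≤c′ = 0≤⇒≤ (subst (0ℤ ≤_) eq
      (lin-nonneg {λ v → c′ v + - 1ℤ * c v} λ {v} v∈ → subst (0ℤ ≤_) (lemma (c′ v) (c v))
        (≤⇒0≤ (c≤c′ v∈))))
      where
      lemma : ∀ a b → a - b ≡ a + - 1ℤ * b
      lemma = solve-∀
      eq : lin (λ v → c′ v + - 1ℤ * c v) T ≡ lin c′ T - lin c T
      eq = trans (lin-+* c′ (- 1ℤ) c T) (sym (lemma (lin c′ T) (lin c T)))

    lin-⊆ : ∀ {c S T} → (∀ v → 0ℤ ≤ c v) → S ⊆ T → lin c S ≤ lin c T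
    lin-⊆ {c} {S} {T} c≥0 S⊆T = begin
      lin c S                   ≡⟨ ℤ.+-identityʳ _ ⟨
      lin c S + 0ℤ              ≤⟨ ℤ.+-monoʳ-≤ (lin c S) (lin-nonneg λ {v} _ → c≥0 v) ⟩
      lin c S + lin c (T ∖ S)   ≡⟨ lin-≐ c (∖-≐ S⊆T) ⟨
      lin c T                   ∎
      where open ≤-Reasoning

    size-∖⁅⁆ : ∀ {T u} → u ∈ T → size T ≡ 1ℤ + size (T ∖ ⁅ u ⁆)
    size-∖⁅⁆ {T} {u} u∈T = trans (lin-≐ (λ _ → 1ℤ) (remove-≐ u∈T))
      (cong (_+ size (T ∖ ⁅ u ⁆)) (lin-⁅⁆ (λ _ → 1ℤ) u))

    size-⊆ : ∀ {S T} → S ⊆ T → size S ≤ size T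
    size-⊆ = lin-⊆ λ _ → +≤+ z≤n

    _⊆?_ : ∀ S T → Dec (S ⊆ T)
    S ⊆? T = map′ (λ h {v} → h v) (λ h v → h) (Fin.all? λ v → (v ∈? S) →-dec (v ∈? T))

    -- The search runs through vectors, of which there are finitely many. A Boolean function agrees
    -- with its tabulation only pointwise, hence the requirement that `P` respect pointwise
    -- equality.
    search : ∀ {P : Sub → Set} → (∀ T → Dec (P T)) →
             (∀ {S T} → (∀ v → S v ≡ T v) → P S → P T) → Dec (∃ P)
    search P? resp = map′ (λ (s , p) → lookup s , p)
      (λ (T , p) → tabulate T , resp (λ v → sym (lookup∘tabulate T v)) p)
        (Subset.anySubset? λ s → P? (lookup s))

    -- Descent: as long as some set satisfying `P` has a smaller value, move to it. The values are
    -- positive integers, so the initial bound `k` limits the number of moves.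
    argmin : ∀ {P : Sub → Set} (f : Sub → ℤ) → (∀ T → Dec (P T)) →
             (∀ {S T} → (∀ v → S v ≡ T v) → P S → P T) →
             (∀ {S T} → (∀ v → S v ≡ T v) → f S ≡ f T) → (∀ {T} → P T → 0ℤ < f T) →
             ∀ k {T} → P T → f T ≤ + k → ∃[ S ] P S × f S ≤ f T × (∀ {R} → P R → f S ≤ f R)
    argmin {P} f P? P-resp f-resp f-pos k {T} pT fT≤k
      with search (λ S → P? S ×-dec (f S ℤ.<? f T))
        (λ S≗R (pS , lt) → P-resp S≗R pS , subst (_< f T) (f-resp S≗R) lt)
    ... | no ∄ = T , pT , ℤ.≤-refl , λ pR → ℤ.≮⇒≥ λ lt → ∄ (_ , pR , lt)
    ... | yes (S , pS , fS<fT) with k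
    ...   | zero  = contradiction (ℤ.<-≤-trans (f-pos pT) fT≤k) (ℤ.<-irrefl refl)
    ...   | suc k′ =
      let R , pR , fR≤fS , min = argmin f P? P-resp f-resp f-pos k′ pS (<⇒≤pred (ℤ.<-≤-trans fS<fT fT≤k))
      in R , pR , ℤ.≤-trans fR≤fS (ℤ.<⇒≤ fS<fT) , min
      where
      <⇒≤pred : f S < + suc k′ → f S ≤ + k′
      <⇒≤pred lt = 0≤⇒≤ (0<⇒0≤-1 (lemma (+ k′) (f S)) (<⇒0< lt))
        where
        lemma : ∀ k s → k - s ≡ 1ℤ + k - s - 1ℤ
        lemma = solve-∀

  -- Degrees, edge counts and potentials

  module Potential {n : ℕ} (adj : Fin n → Fin n → Bool)
    (adj-sym : ∀ u v → adj u v ≡ adj v u) (adj-irrefl : ∀ u → adj u u ≡ false)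
    (N : ℤ) (0<N : 0ℤ < N) where
    open Sets n

    loopless : ∀ {u} → u ∉ adj u
    loopless {u} (mem uu) = contradiction (trans (sym uu) (adj-irrefl u)) λ ()

    adj-swap : ∀ {a b} → b ∈ adj a → a ∈ adj b
    adj-swap {a} {b} (mem ab) = mem (trans (adj-sym b a) ab)

    0≤N : 0ℤ ≤ N
    0≤N = ℤ.<⇒≤ 0<N

    0≤2N : 0ℤ ≤ + 2 * N
    0≤2N = 0≤* {+ 2} (+≤+ z≤n) 0≤N

    deg : Sub → Fin n → ℤ
    deg T u = lin (𝟙 ∘ adj u) T

    edges : Sub → Sub → ℤ
    edges S T = lin (deg T) S

    0≤deg : ∀ T u → 0ℤ ≤ deg T u
    0≤deg T u = lin-nonneg λ {v} _ → 0≤𝟙 (adj u v)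

    0≤edges : ∀ S T → 0ℤ ≤ edges S T
    0≤edges S T = lin-nonneg λ {u} _ → 0≤deg T u

    deg-⊆ : ∀ {S T} u → S ⊆ T → deg S u ≤ deg T u
    deg-⊆ u = lin-⊆ λ v → 0≤𝟙 (adj u v)

    adj⇒1≤deg : ∀ {T u v} → v ∈ T → v ∈ adj u → 1ℤ ≤ deg T u
    adj⇒1≤deg {T} {u} {v} v∈T uv = begin
      1ℤ                 ≡⟨ ∈⇒𝟙≡1 uv ⟨
      𝟙 (adj u v)        ≡⟨ lin-⁅⁆ (𝟙 ∘ adj u) v ⟨
      deg ⁅ v ⁆ u        ≤⟨ deg-⊆ u (∈⇒⁅⁆⊆ v∈T) ⟩
      deg T u            ∎
      where open ≤-Reasoning

    1≤deg⇒adj : ∀ {T u} → 1ℤ ≤ deg T u → ∃[ v ] v ∈ T × v ∈ adj u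
    1≤deg⇒adj {T} {u} 1≤d with lin-pos⇒∃ {c = 𝟙 ∘ adj u} (ℤ.<-≤-trans (+<+ (s≤s z≤n)) 1≤d)
    ... | v , v∈T , 0<uv = v , v∈T , 0<𝟙⇒∈ 0<uv

    edges-sym : ∀ S T → edges S T ≡ edges T S
    edges-sym S T = trans (lin-swap (λ u v → 𝟙 (adj u v)) S T)
      (lin-≡ λ {v} _ → lin-≡ λ {u} _ → cong 𝟙 (adj-sym u v))

    edges-≐ˡ : ∀ {T P Q} S → T ≐ P ⊎ Q → edges T S ≡ edges P S + edges Q S
    edges-≐ˡ S = lin-≐ (deg S)

    edges-≐ʳ : ∀ {T P Q} S → T ≐ P ⊎ Q → edges S T ≡ edges S P + edges S Q
    edges-≐ʳ {T} {P} {Q} S T≐ = trans (edges-sym S T)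
      (trans (edges-≐ˡ S T≐) (cong₂ _+_ (edges-sym P S) (edges-sym Q S)))

    -- edges T T counts every edge of T twice, so the edge term is 2N e(T).
    Φ : (Fin n → ℤ) → Sub → ℤ
    Φ κ T = lin κ T - N * edges T T

    -- An edge between `P` and `Q` is counted once by `edges P Q` but twice by `edges T T`, hence
    -- the factor 2.
    Φ-≐ : ∀ κ {T P Q} → T ≐ P ⊎ Q → Φ κ T ≡ Φ κ P + Φ κ Q - + 2 * (N * edges P Q)
    Φ-≐ κ {T} {P} {Q} T≐ = trans
      (cong₂ (λ a b → a - N * b) (lin-≐ κ T≐)
        (trans (edges-≐ˡ T T≐) (cong₂ _+_ (edges-≐ʳ P T≐)
          (trans (edges-≐ʳ Q T≐) (cong (_+ edges Q Q) (edges-sym Q P))))))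
      (lemma N (lin κ P) (lin κ Q) (edges P P) (edges P Q) (edges Q Q))
      where
      lemma : ∀ N p q a b c → p + q - N * ((a + b) + (b + c)) ≡
              (p - N * a) + (q - N * c) - + 2 * (N * b)
      lemma = solve-∀

    Φ-cong : ∀ κ {S T} → (∀ v → S v ≡ T v) → Φ κ S ≡ Φ κ T
    Φ-cong κ {S} {T} S≗T = cong₂ (λ a b → a - N * b) (lin-cong κ S≗T)
      (trans (lin-cong (deg S) S≗T) (lin-≡ λ {u} _ → lin-cong (𝟙 ∘ adj u) S≗T))

    Φ-⁅⁆ : ∀ κ u → Φ κ ⁅ u ⁆ ≡ κ u
    Φ-⁅⁆ κ u = trans (cong₂ (λ a b → a - N * b) (lin-⁅⁆ κ u)
        (trans (lin-⁅⁆ (deg ⁅ u ⁆) u) (trans (lin-⁅⁆ (𝟙 ∘ adj u) u) (cong 𝟙 (adj-irrefl u)))))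
      (lemma N (κ u))
      where
      lemma : ∀ N a → a - N * 0ℤ ≡ a
      lemma = solve-∀

    Φ-insert : ∀ κ {T u Q} → T ≐ ⁅ u ⁆ ⊎ Q → Φ κ T ≡ κ u + Φ κ Q - + 2 * (N * deg Q u)
    Φ-insert κ {T} {u} {Q} T≐ = trans (Φ-≐ κ T≐)
      (cong₂ (λ a b → a + Φ κ Q - + 2 * (N * b)) (Φ-⁅⁆ κ u) (lin-⁅⁆ (deg Q) u))

    Φ-shift : ∀ κ k c T → Φ (λ v → κ v + k * c v) T ≡ Φ κ T + k * lin c T
    Φ-shift κ k c T = trans (cong (_- N * edges T T) (lin-+* κ k c T))
      (lemma (lin κ T) (k * lin c T) (N * edges T T))
      where
      lemma : ∀ a b c → a + b - c ≡ a - c + b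
      lemma = solve-∀

    Φ-empty : ∀ κ {T} → ¬ Nonempty T → Φ κ T ≡ 0ℤ
    Φ-empty κ {T} ∅ = trans (cong₂ (λ a b → a - N * b) (lin-empty κ ∅) (lin-empty (deg T) ∅))
      (lemma N)
      where
      lemma : ∀ N → 0ℤ - N * 0ℤ ≡ 0ℤ
      lemma = solve-∀

    -- Averaging: `Φ κ T` is the sum of `κ v - N * deg T v` over `T`, so some summand is positive.
    Φ-pos⇒∃ : ∀ {κ T} → 0ℤ < Φ κ T → ∃[ v ] v ∈ T × N * deg T v < κ v
    Φ-pos⇒∃ {κ} {T} 0<Φ with lin-pos⇒∃ {c = λ v → κ v + - N * deg T v}
      (0<-resp (trans (lin-+* κ (- N) (deg T) T) (lemma (lin κ T) N (edges T T))) 0<Φ)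
      where
      lemma : ∀ a N b → a + - N * b ≡ a - N * b
      lemma = solve-∀
    ... | v , v∈T , p = v , v∈T , 0<⇒< (0<-resp (lemma (κ v) N (deg T v)) p)
      where
      lemma : ∀ a N b → a - N * b ≡ a + - N * b
      lemma = solve-∀

    count : Sub → Sub → ℤ
    count U = lin (𝟙 ∘ U)

    -- Each undecided vertex carries an extra credit of `N` for the option of placing it in the
    -- independent set.
    Γ : Sub → (Fin n → ℤ) → Sub → ℤ
    Γ U κ T = Φ κ T + N * count U T

    0≤count : ∀ U T → 0ℤ ≤ count U T
    0≤count U T = lin-nonneg λ {v} _ → 0≤𝟙 (U v)

    Γ-≐ : ∀ U κ {T P Q} → T ≐ P ⊎ Q → Γ U κ T ≡ Γ U κ P + Γ U κ Q - + 2 * (N * edges P Q)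
    Γ-≐ U κ {T} {P} {Q} T≐ = trans (cong₂ (λ a b → a + N * b) (Φ-≐ κ T≐) (lin-≐ (𝟙 ∘ U) T≐))
      (lemma (Φ κ P) (Φ κ Q) (+ 2 * (N * edges P Q)) N (count U P) (count U Q))
      where
      lemma : ∀ a b e N p q → a + b - e + N * (p + q) ≡ a + N * p + (b + N * q) - e
      lemma = solve-∀

    Γ-insert : ∀ U κ {T u Q} → T ≐ ⁅ u ⁆ ⊎ Q →
               Γ U κ T ≡ κ u + N * 𝟙 (U u) + Γ U κ Q - + 2 * (N * deg Q u)
    Γ-insert U κ {T} {u} {Q} T≐ = trans (Γ-≐ U κ T≐)
      (cong₂ (λ a b → a + Γ U κ Q - + 2 * (N * b))
        (cong₂ (λ a b → a + N * b) (Φ-⁅⁆ κ u) (lin-⁅⁆ (𝟙 ∘ U) u)) (lin-⁅⁆ (deg Q) u))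

    Positive : Sub → Sub → (Fin n → ℤ) → Set
    Positive V U κ = ∀ {T} → T ⊆ V → Nonempty T → 0ℤ < Γ U κ T

    record Solution (V U : Sub) (κ : Fin n → ℤ) : Set where
      field
        I     : Sub
        I⊆U   : I ⊆ U
        indep : ∀ {u v} → u ∈ I → v ∈ I → v ∉ adj u
        pos   : ∀ {T} → T ⊆ V ∖ I → Nonempty T → 0ℤ < Φ κ T

    N*-cancel-< : ∀ {a b} → N * a < N * b → a < b
    N*-cancel-< = ℤ.*-cancelˡ-<-nonNeg N {{nonNegative 0≤N}}

    -- Deleting a vertex of small degree

    -- Adding a vertex `u` with exactly one neighbour in `T` changes `Φ κ T` by `κ u - 2N`. Charging
    -- this to the neighbours of `u` in advance lets `u` be deleted and put back later.
    lower : (Fin n → ℤ) → Fin n → Fin n → ℤ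
    lower κ u v = κ v + - (+ 2 * N - κ u) * 𝟙 (adj u v)

    Φ-lower : ∀ κ u T → Φ (lower κ u) T ≡ Φ κ T + - (+ 2 * N - κ u) * deg T u
    Φ-lower κ u = Φ-shift κ (- (+ 2 * N - κ u)) (𝟙 ∘ adj u)

    lower≤ : ∀ {κ u} → κ u ≤ + 2 * N → ∀ v → lower κ u v ≤ κ v
    lower≤ {κ} {u} κu≤ v = 0≤⇒≤ (0≤-resp (lemma (κ v) (+ 2 * N - κ u) (𝟙 (adj u v)))
      (0≤* (≤⇒0≤ κu≤) (0≤𝟙 (adj u v))))
      where
      lemma : ∀ a r t → a - (a + - r * t) ≡ r * t
      lemma = solve-∀

    Φ-mono : ∀ {κ κ′} T → (∀ v → κ v ≤ κ′ v) → Φ κ T ≤ Φ κ′ T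
    Φ-mono T κ≤κ′ = ℤ.+-monoˡ-≤ (- (N * edges T T)) (lin-mono λ {v} _ → κ≤κ′ v)

    Γ-lower : ∀ U κ u T → Γ U (lower κ u) T ≡ Γ U κ T - (+ 2 * N - κ u) * deg T u
    Γ-lower U κ u T = trans (cong (_+ N * count U T) (Φ-lower κ u T))
      (lemma (Φ κ T) (+ 2 * N - κ u) (deg T u) (N * count U T))
      where
      lemma : ∀ a r d c → a + - r * d + c ≡ a + c - r * d
      lemma = solve-∀

    -- Puts `u` back into the forest part. If `T` consists of `u` and `Q`, then `Φ κ T` exceeds
    -- `Φ (lower κ u) Q` by `κ u * (1 - deg Q u)`, which is nonnegative when `u` has at most one
    -- neighbour in `Q`. The empty `Q` is separate and leaves `κ u` itself.
    reinsert : ∀ {V I κ u} → 0ℤ < κ u → κ u ≤ + 2 * N →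
               (∀ {T} → T ⊆ V ∖ ⁅ u ⁆ ∖ I → Nonempty T → 0ℤ < Φ (lower κ u) T) →
               (∀ {T} → T ⊆ V ∖ I → deg T u ≤ 1ℤ) →
               ∀ {T} → T ⊆ V ∖ I → Nonempty T → 0ℤ < Φ κ T
    reinsert {V} {I} {κ} {u} 0<κu κu≤ pos′ deg≤1 {T} T⊆ ne with u ∈? T
    ... | no u∉T = ℤ.<-≤-trans (pos′ T⊆′ ne) (Φ-mono T (lower≤ {κ} κu≤))
      where
      T⊆′ : T ⊆ V ∖ ⁅ u ⁆ ∖ I
      T⊆′ v∈T = let v∈V , v∉I = ∈∖⁻ (T⊆ v∈T) in
        ∈∖⁺ (∈∖⁺ v∈V λ v∈ → u∉T (subst (_∈ T) (sym (∈⁅⁆⁻ v∈)) v∈T)) v∉I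
    ... | yes u∈T = 0<-resp eq (split-ne (nonempty? Q))
      where
      Q = T ∖ ⁅ u ⁆
      Q⊆′ : Q ⊆ V ∖ ⁅ u ⁆ ∖ I
      Q⊆′ v∈Q = let v∈T , v∉u = ∈∖⁻ v∈Q ; v∈V , v∉I = ∈∖⁻ (T⊆ v∈T) in ∈∖⁺ (∈∖⁺ v∈V v∉u) v∉I
      Q⊆ : Q ⊆ V ∖ I
      Q⊆ v∈Q = T⊆ (proj₁ (∈∖⁻ v∈Q))
      eq : Φ κ T ≡ Φ (lower κ u) Q + κ u * (1ℤ - deg Q u)
      eq = trans (Φ-insert κ (remove-≐ u∈T)) (trans (lemma N (κ u) (Φ κ Q) (deg Q u))
             (cong (_+ κ u * (1ℤ - deg Q u)) (sym (Φ-lower κ u Q))))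
        where
        lemma : ∀ N k f d → k + f - + 2 * (N * d) ≡ f + - (+ 2 * N - k) * d + k * (1ℤ - d)
        lemma = solve-∀
      split-ne : Dec (Nonempty Q) → 0ℤ < Φ (lower κ u) Q + κ u * (1ℤ - deg Q u)
      split-ne (yes ne) = 0<+ (pos′ Q⊆′ ne) (0≤* (ℤ.<⇒≤ 0<κu) (≤⇒0≤ (deg≤1 Q⊆)))
      split-ne (no ∅) = 0<-resp
        (trans (cong₂ (λ a b → a + κ u * (1ℤ - b)) (Φ-empty (lower κ u) ∅)
          (lin-empty (𝟙 ∘ adj u) ∅))
          (lemma (κ u))) 0<κu
        where
        lemma : ∀ k → 0ℤ + k * (1ℤ - 0ℤ) ≡ k
        lemma = solve-∀

    Γ-insert∉ : ∀ U κ {u Q} → u ∉ U → u ∉ Q →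
                Γ U κ (⁅ u ⁆ ∪ Q) ≡ κ u + Γ U κ Q - + 2 * (N * deg Q u)
    Γ-insert∉ U κ {u} {Q} u∉U u∉Q = trans (Γ-insert U κ (insert-≐ u∉Q))
      (trans (cong (λ b → κ u + N * b + Γ U κ Q - + 2 * (N * deg Q u)) (∉⇒𝟙≡0 u∉U))
             (lemma (κ u) N (Γ U κ Q) (+ 2 * (N * deg Q u))))
      where
      lemma : ∀ k N g e → k + N * 0ℤ + g - e ≡ k + g - e
      lemma = solve-∀

    Γ-insert∈ : ∀ U κ {u Q} → u ∈ U → u ∉ Q →
                Γ U κ (⁅ u ⁆ ∪ Q) ≡ κ u + N + Γ U κ Q - + 2 * (N * deg Q u)
    Γ-insert∈ U κ {u} {Q} u∈U u∉Q = trans (Γ-insert U κ (insert-≐ u∉Q))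
      (trans (cong (λ b → κ u + N * b + Γ U κ Q - + 2 * (N * deg Q u)) (∈⇒𝟙≡1 u∈U))
             (lemma (κ u) N (Γ U κ Q) (+ 2 * (N * deg Q u))))
      where
      lemma : ∀ k N g e → k + N * 1ℤ + g - e ≡ k + N + g - e
      lemma = solve-∀

    ⁅⁆∪⊆ : ∀ {u Q V} → u ∈ V → Q ⊆ V ∖ ⁅ u ⁆ → ⁅ u ⁆ ∪ Q ⊆ V
    ⁅⁆∪⊆ {V = V} u∈V Q⊆ v∈ = [ (λ v∈u → subst (_∈ V) (∈⁅⁆⁻ v∈u) u∈V) ,
      (λ v∈Q → proj₁ (∈∖⁻ (Q⊆ v∈Q))) ]′ (∈∪⁻ v∈)

    u∉ : ∀ {u Q V} → Q ⊆ V ∖ ⁅ u ⁆ → u ∉ Q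
    u∉ Q⊆ u∈Q = proj₂ (∈∖⁻ (Q⊆ u∈Q)) u∈⁅u⁆

    Γ-insert-pos : ∀ {V U κ u T} → Positive V U κ → u ∈ V → T ⊆ V ∖ ⁅ u ⁆ → 0ℤ < Γ U κ (⁅ u ⁆ ∪ T)
    Γ-insert-pos pos u∈V T⊆ = pos (⁅⁆∪⊆ u∈V T⊆) (_ , ∈∪⁺ˡ u∈⁅u⁆)

    -- If `u` has one neighbour in `T`, the lowered potential of `T` equals the original potential
    -- of `T` with `u` added; if it has none, lowering changes nothing. As in the reductions below,
    -- the result pairs positivity of the smaller instance with a way to extend its solution.
    addForest : ∀ {V U κ u} → (∀ v → κ v ≤ + 2 * N) → u ∈ V → u ∉ U → deg V u ≤ 1ℤ →
      Positive V U κ →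
                Positive (V ∖ ⁅ u ⁆) U (lower κ u)
              × (Solution (V ∖ ⁅ u ⁆) U (lower κ u) → Solution V U κ)
    addForest {V} {U} {κ} {u} κ≤ u∈V u∉U deg≤1 pos = pos′ , λ s → record
      { I     = Solution.I s
      ; I⊆U   = Solution.I⊆U s
      ; indep = Solution.indep s
      ; pos   = reinsert {I = Solution.I s} {κ = κ} 0<κu (κ≤ u) (Solution.pos s)
                  λ T⊆ → ℤ.≤-trans (deg-⊆ u λ v∈ → proj₁ (∈∖⁻ (T⊆ v∈))) deg≤1
      }
      where
      0<κu : 0ℤ < κ u
      0<κu = 0<-resp (sym (trans
        (cong₂ (λ a b → a + N * b) (Φ-⁅⁆ κ u) (trans (lin-⁅⁆ (𝟙 ∘ U) u) (∉⇒𝟙≡0 u∉U)))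
          (lemma (κ u) N)))
               (pos (∈⇒⁅⁆⊆ u∈V) (u , u∈⁅u⁆))
        where
        lemma : ∀ k N → k + N * 0ℤ ≡ k
        lemma = solve-∀
      pos′ : Positive (V ∖ ⁅ u ⁆) U (lower κ u)
      pos′ {T} T⊆ ne = 0<-resp (Γ-lower U κ u T)
        (cases (≤1⇒≡ (0≤deg T u) (ℤ.≤-trans (deg-⊆ u λ v∈ → proj₁ (∈∖⁻ (T⊆ v∈))) deg≤1)))
        where
        cases : deg T u ≡ 0ℤ ⊎ deg T u ≡ 1ℤ → 0ℤ < Γ U κ T - (+ 2 * N - κ u) * deg T u
        cases (inj₁ d) = 0<-resp (trans (cong (λ d → Γ U κ T - (+ 2 * N - κ u) * d) d)
          (lemma (Γ U κ T) (+ 2 * N - κ u)))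
            (pos (λ v∈ → proj₁ (∈∖⁻ (T⊆ v∈))) ne)
          where
          lemma : ∀ g r → g - r * 0ℤ ≡ g
          lemma = solve-∀
        cases (inj₂ d) = 0<-resp (trans (cong (λ d → Γ U κ T - (+ 2 * N - κ u) * d) d)
          (lemma N (κ u) (Γ U κ T)))
            (0<-resp (sym (trans (Γ-insert∉ U κ u∉U (u∉ T⊆))
              (cong (λ d → κ u + Γ U κ T - + 2 * (N * d)) d)))
              (Γ-insert-pos pos u∈V T⊆))
          where
          lemma : ∀ N k g → g - (+ 2 * N - k) * 1ℤ ≡ k + g - + 2 * (N * 1ℤ)
          lemma = solve-∀

    ∖⊆ : ∀ {S T} → S ∖ T ⊆ S
    ∖⊆ v∈ = proj₁ (∈∖⁻ v∈)

    ⊆-trans : ∀ {S T R} → S ⊆ T → T ⊆ R → S ⊆ R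
    ⊆-trans S⊆T T⊆R v∈ = T⊆R (S⊆T v∈)

    count-∖ : ∀ {U S T} → (∀ {v} → v ∈ T → v ∉ S) → count (U ∖ S) T ≡ count U T
    count-∖ {U} {S} {T} disj = lin-≡ eq
      where
      eq : ∀ {v} → v ∈ T → 𝟙 ((U ∖ S) v) ≡ 𝟙 (U v)
      eq {v} v∈T with v ∈? U
      ... | yes v∈U = trans (∈⇒𝟙≡1 (∈∖⁺ v∈U (disj v∈T))) (sym (∈⇒𝟙≡1 v∈U))
      ... | no  v∉U = trans (∉⇒𝟙≡0 (λ v∈ → v∉U (proj₁ (∈∖⁻ v∈)))) (sym (∉⇒𝟙≡0 v∉U))

    count-≐ : ∀ {U P Q} T → U ≐ P ⊎ Q → count U T ≡ count P T + count Q T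
    count-≐ {U} {P} {Q} T (split U≐) = trans (lin-≡ λ {v} _ → U≐ v) (lin-+ (𝟙 ∘ P) (𝟙 ∘ Q) T)

    𝟙-mono : ∀ {P Q v} → (v ∈ P → v ∈ Q) → 𝟙 (P v) ≤ 𝟙 (Q v)
    𝟙-mono {P} {Q} {v} imp with v ∈? P
    ... | yes v∈P = ℤ.≤-reflexive (trans (∈⇒𝟙≡1 v∈P) (sym (∈⇒𝟙≡1 (imp v∈P))))
    ... | no  v∉P = ℤ.≤-trans (ℤ.≤-reflexive (∉⇒𝟙≡0 v∉P)) (0≤𝟙 (Q v))

    Γ-∖⁅⁆ : ∀ {V U κ u T} → T ⊆ V ∖ ⁅ u ⁆ → Γ (U ∖ ⁅ u ⁆) κ T ≡ Γ U κ T
    Γ-∖⁅⁆ {κ = κ} {T = T} T⊆ = cong (λ c → Φ κ T + N * c) (count-∖ λ v∈T → proj₂ (∈∖⁻ (T⊆ v∈T)))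

    Γ-nonneg : ∀ {V U κ T} → Positive V U κ → T ⊆ V → 0ℤ ≤ Γ U κ T
    Γ-nonneg {V} {U} {κ} {T} pos T⊆V with nonempty? T
    ... | yes ne = ℤ.<⇒≤ (pos T⊆V ne)
    ... | no  ∅  = 0≤-resp (trans (cong₂ (λ a b → a + N * b) (Φ-empty κ ∅) (lin-empty (𝟙 ∘ U) ∅))
      (lemma N)) ℤ.≤-refl
      where
      lemma : ∀ N → 0ℤ + N * 0ℤ ≡ 0ℤ
      lemma = solve-∀

    -- With `u` in the independent set, the forest part is the same as in the smaller solution, and
    -- raising the weights from `κ′` to `κ` only helps.
    include : ∀ {V U U′ κ κ′ u} → U′ ⊆ U → u ∈ U → (∀ v → κ′ v ≤ κ v) →
              (s : Solution (V ∖ ⁅ u ⁆) U′ κ′) → (∀ {v} → v ∈ Solution.I s → v ∉ adj u) →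
              Solution V U κ
    include {V} {U} {U′} {κ} {κ′} {u} U′⊆U u∈U κ′≤κ s far = record
      { I     = ⁅ u ⁆ ∪ I
      ; I⊆U   = λ v∈ → [ ∈⇒⁅⁆⊆ u∈U , (λ v∈I → U′⊆U (I⊆U v∈I)) ]′ (∈∪⁻ v∈)
      ; indep = λ a∈ b∈ → indep′ (∈∪⁻ a∈) (∈∪⁻ b∈)
      ; pos   = λ {T} T⊆ ne → ℤ.<-≤-trans (pos (T⊆′ T⊆) ne) (Φ-mono T κ′≤κ)
      }
      where
      open Solution s
      indep′ : ∀ {a b} → a ∈ ⁅ u ⁆ ⊎ a ∈ I → b ∈ ⁅ u ⁆ ⊎ b ∈ I → b ∉ adj a
      indep′ (inj₁ a∈) (inj₁ b∈) rewrite sym (∈⁅⁆⁻ a∈) | sym (∈⁅⁆⁻ b∈) = loopless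
      indep′ (inj₁ a∈) (inj₂ b∈) rewrite sym (∈⁅⁆⁻ a∈) = far b∈
      indep′ (inj₂ a∈) (inj₁ b∈) rewrite sym (∈⁅⁆⁻ b∈) = far a∈ ∘ adj-swap
      indep′ (inj₂ a∈) (inj₂ b∈) = indep a∈ b∈
      T⊆′ : ∀ {T} → T ⊆ V ∖ (⁅ u ⁆ ∪ I) → T ⊆ V ∖ ⁅ u ⁆ ∖ I
      T⊆′ T⊆ v∈T = let v∈V , v∉ = ∈∖⁻ (T⊆ v∈T) in ∈∖⁺ (∈∖⁺ v∈V (v∉ ∘ ∈∪⁺ˡ)) (v∉ ∘ ∈∪⁺ʳ)

    -- Committing `u` to the independent set in advance removes its neighbours from `U`. Each
    -- undecided neighbour in `T` then loses its credit `N`, and the hypothesis says that the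
    -- potential can pay for this.
    chooseIndependent : ∀ {V U κ u} → u ∈ U →
      (∀ {T} → T ⊆ V ∖ ⁅ u ⁆ → Nonempty T → 0ℤ < Γ U κ T - N * count (U ∩ adj u) T) →
      Positive (V ∖ ⁅ u ⁆) (U ∖ adj u ∖ ⁅ u ⁆) κ ×
        (Solution (V ∖ ⁅ u ⁆) (U ∖ adj u ∖ ⁅ u ⁆) κ → Solution V U κ)
    chooseIndependent {V} {U} {κ} {u} u∈U h =
      (λ {T} T⊆ ne → 0<-resp (trans (Γ-∖⁅⁆ {V} {U ∖ adj u} {κ} T⊆) (eq T)) (h T⊆ ne)) ,
      λ s → include (⊆-trans ∖⊆ ∖⊆) u∈U (λ v → ℤ.≤-refl) s λ v∈I → proj₂
        (∈∖⁻ (∖⊆ (Solution.I⊆U s v∈I)))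
      where
      eq : ∀ T → Γ (U ∖ adj u) κ T ≡ Γ U κ T - N * count (U ∩ adj u) T
      eq T = trans (lemma (Φ κ T) N (count (U ∖ adj u) T) (count (U ∩ adj u) T))
        (cong (λ c → Φ κ T + N * c - N * count (U ∩ adj u) T) (sym (count-≐ T (∩∖-≐ U (adj u)))))
        where
        lemma : ∀ f N a b → f + N * a ≡ f + N * (b + a) - N * b
        lemma = solve-∀

    deg-step : ∀ {V I u v T} → I ⊆ V → v ∈ I → v ∈ adj u → T ⊆ V ∖ I → deg T u + 1ℤ ≤ deg V u
    deg-step {V} {I} {u} {v} {T} I⊆V v∈I uv T⊆ = begin
      deg T u + 1ℤ           ≤⟨ ℤ.+-mono-≤ (deg-⊆ u T⊆) (adj⇒1≤deg v∈I uv) ⟩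
      deg (V ∖ I) u + deg I u  ≡⟨ ℤ.+-comm (deg (V ∖ I) u) (deg I u) ⟩
      deg I u + deg (V ∖ I) u  ≡⟨ lin-≐ (𝟙 ∘ adj u) (∖-≐ I⊆V) ⟨
      deg V u                ∎
      where open ≤-Reasoning

    -- The place of `u` is chosen after the smaller instance is solved. Only when `I` already
    -- contains a neighbour of `u` must `u` join the forest part, so `h` may assume such a
    -- neighbour.
    include-or-reinsert : ∀ {V U κ κ′ u} → u ∈ U → 0ℤ < κ u → κ u ≤ + 2 * N → (∀ v → κ′ v ≤ κ v) →
      (s : Solution (V ∖ ⁅ u ⁆) (U ∖ ⁅ u ⁆) κ′) →
      (∀ {v} → v ∈ Solution.I s → v ∈ adj u →
         (∀ {T} → T ⊆ V ∖ ⁅ u ⁆ ∖ Solution.I s → Nonempty T → 0ℤ < Φ (lower κ u) T)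
       × (∀ {T} → T ⊆ V ∖ Solution.I s → deg T u ≤ 1ℤ)) →
      Solution V U κ
    include-or-reinsert {V} {U} {κ} {κ′} {u} u∈U 0<κu κu≤ κ′≤κ s h
      with nonempty? (Solution.I s ∩ adj u)
    ... | no ∅ = include ∖⊆ u∈U κ′≤κ s λ v∈I uv → ∅ (_ , ∈∩⁺ v∈I uv)
    ... | yes (v , v∈) = record
      { I     = Solution.I s
      ; I⊆U   = ⊆-trans (Solution.I⊆U s) ∖⊆
      ; indep = Solution.indep s
      ; pos   = reinsert {I = Solution.I s} {κ = κ} 0<κu κu≤ (proj₁ hv) (proj₂ hv)
      }
      where
      hv = h (proj₁ (∈∩⁻ v∈)) (proj₂ (∈∩⁻ v∈))

    addLeaf : ∀ {V U κ u} → U ⊆ V → u ∈ U → 0ℤ < κ u → κ u ≤ + 2 * N → deg V u ≤ 1ℤ →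
      Positive V U κ →
      Positive (V ∖ ⁅ u ⁆) (U ∖ ⁅ u ⁆) κ × (Solution (V ∖ ⁅ u ⁆) (U ∖ ⁅ u ⁆) κ → Solution V U κ)
    addLeaf {V} {U} {κ} {u} U⊆V u∈U 0<κu κu≤ deg≤1 pos =
      (λ {T} T⊆ ne → 0<-resp (Γ-∖⁅⁆ {V} {U} {κ} T⊆) (pos (⊆-trans T⊆ ∖⊆) ne)) ,
      λ s → include-or-reinsert u∈U 0<κu κu≤ (λ v → ℤ.≤-refl) s (side s)
      where
      side : (s : Solution (V ∖ ⁅ u ⁆) (U ∖ ⁅ u ⁆) κ) → ∀ {v} → v ∈ Solution.I s → v ∈ adj u →
         (∀ {T} → T ⊆ V ∖ ⁅ u ⁆ ∖ Solution.I s → Nonempty T → 0ℤ < Φ (lower κ u) T)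
       × (∀ {T} → T ⊆ V ∖ Solution.I s → deg T u ≤ 1ℤ)
      side s v∈I uv =
        (λ {T} T⊆ ne → 0<-resp (trans (Φ-lower κ u T)
          (trans (cong (λ d → Φ κ T + - (+ 2 * N - κ u) * d)
             (ℤ.≤-antisym (deg≤0 λ v∈T → ∈∖⁺ (proj₁ (∈∖⁻ (proj₁ (∈∖⁻ (T⊆ v∈T)))))
               (proj₂ (∈∖⁻ (T⊆ v∈T)))) (0≤deg T u)))
             (lemma (Φ κ T) (+ 2 * N - κ u)))) (Solution.pos s T⊆ ne)) ,
        λ T⊆ → ℤ.≤-trans (deg≤0 T⊆) (+≤+ z≤n)
        where
        lemma : ∀ f r → f + - r * 0ℤ ≡ f
        lemma = solve-∀
        deg≤0 : ∀ {T} → T ⊆ V ∖ Solution.I s → deg T u ≤ 0ℤ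
        deg≤0 {T} T⊆ = 0≤⇒≤ (0≤-resp (lemma′ (deg T u)) (≤⇒0≤ (ℤ.≤-trans
            (deg-step (λ v∈I → U⊆V (∖⊆ (Solution.I⊆U s v∈I))) v∈I uv T⊆) deg≤1)))
          where
          lemma′ : ∀ d → 0ℤ - d ≡ 1ℤ - (d + 1ℤ)
          lemma′ = solve-∀

    -- Positivity after lowering is inherited if `T` contains no neighbour of `u`, is the assumption
    -- `big` if it contains one, and follows from `N < κ u` if it contains two. When `u` returns to
    -- the forest part, one of its neighbours is in `I`, so at most one remains.
    addDegreeTwo : ∀ {V U κ u} → U ⊆ V → u ∈ U → N < κ u → κ u ≤ + 2 * N → deg V u ≤ + 2 →
      Positive V U κ →
      (∀ {T} → T ⊆ V ∖ ⁅ u ⁆ → 1ℤ ≤ deg T u → + 2 * N - κ u < Γ U κ T) →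
      Positive (V ∖ ⁅ u ⁆) (U ∖ ⁅ u ⁆) (lower κ u) ×
        (Solution (V ∖ ⁅ u ⁆) (U ∖ ⁅ u ⁆) (lower κ u) → Solution V U κ)
    addDegreeTwo {V} {U} {κ} {u} U⊆V u∈U N<κu κu≤ deg≤2 pos big =
      (λ {T} T⊆ ne → 0<-resp (trans (Γ-∖⁅⁆ {V} {U} {lower κ u} T⊆) (Γ-lower U κ u T))
         (cases T⊆ ne (≤2⇒≡ (0≤deg T u) (ℤ.≤-trans (deg-⊆ u (⊆-trans T⊆ ∖⊆)) deg≤2)))) ,
      λ s → include-or-reinsert u∈U (ℤ.<-trans 0<N N<κu) κu≤ (lower≤ {κ} κu≤) s λ v∈I uv →
        Solution.pos s , λ {T} T⊆ → 0≤⇒≤ (0≤-resp (lemma′ (deg T u)) (≤⇒0≤ (ℤ.≤-trans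
            (deg-step (λ v∈I → U⊆V (∖⊆ (Solution.I⊆U s v∈I))) v∈I uv T⊆) deg≤2)))
      where
      lemma′ : ∀ d → 1ℤ - d ≡ + 2 - (d + 1ℤ)
      lemma′ = solve-∀
      cases : ∀ {T} → T ⊆ V ∖ ⁅ u ⁆ → Nonempty T → (deg T u ≡ 0ℤ ⊎ deg T u ≡ 1ℤ) ⊎ deg T u ≡ + 2 →
              0ℤ < Γ U κ T - (+ 2 * N - κ u) * deg T u
      cases {T} T⊆ ne (inj₁ (inj₁ d)) =
        0<-resp (trans (cong (λ d → Γ U κ T - (+ 2 * N - κ u) * d) d)
          (lemma (Γ U κ T) (+ 2 * N - κ u))) (pos (⊆-trans T⊆ ∖⊆) ne)
        where
        lemma : ∀ g r → g - r * 0ℤ ≡ g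
        lemma = solve-∀
      cases {T} T⊆ ne (inj₁ (inj₂ d)) =
        0<-resp (trans (cong (λ d → Γ U κ T - (+ 2 * N - κ u) * d) d)
          (lemma (Γ U κ T) (+ 2 * N - κ u))) (<⇒0< (big T⊆ (ℤ.≤-reflexive (sym d))))
        where
        lemma : ∀ g r → g - r * 1ℤ ≡ g - r
        lemma = solve-∀
      -- Lowering costs `4N - 2 * κ u`, whereas adding `u` to `T` changes the potential by
      -- `κ u - 3N`; the first result exceeds the second by `κ u - N`.
      cases {T} T⊆ ne (inj₂ d) = 0<-resp
          (trans (cong (λ d → Γ U κ T - (+ 2 * N - κ u) * d) d) (lemma N (κ u) (Γ U κ T)))
          (0<+ (0<-resp (sym (trans (Γ-insert∈ U κ u∈U (u∉ T⊆))
            (cong (λ d → κ u + N + Γ U κ T - + 2 * (N * d)) d)))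
                  (Γ-insert-pos pos (U⊆V u∈U) T⊆))
               (ℤ.<⇒≤ (<⇒0< N<κu)))
        where
        lemma : ∀ N k g → g - (+ 2 * N - k) * + 2 ≡ (k + N + g - + 2 * (N * + 2)) + (k - N)
        lemma = solve-∀

    count-adj≤deg : ∀ U u T → count (U ∩ adj u) T ≤ deg T u
    count-adj≤deg U u T = lin-mono λ _ → 𝟙-mono λ v∈ → proj₂ (∈∩⁻ v∈)

    -- Since `{u}` has potential `κ u ≤ 0`, `u` must be independent. If its neighbour in `T` is
    -- undecided, adding `u` to `T` changes the potential by `κ u + N - 2N`, which is at most `-N`;
    -- the larger set is still positive, so `T` can pay `N`.
    forcedLeaf : ∀ {V U κ u} → U ⊆ V → u ∈ U → κ u ≤ 0ℤ → deg V u ≤ 1ℤ →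
      Positive V U κ →
      ∀ {T} → T ⊆ V ∖ ⁅ u ⁆ → Nonempty T → 0ℤ < Γ U κ T - N * count (U ∩ adj u) T
    forcedLeaf {V} {U} {κ} {u} U⊆V u∈U κu≤0 deg≤1 pos {T} T⊆ ne =
      cases (≤1⇒≡ (0≤count (U ∩ adj u) T) (ℤ.≤-trans (count-adj≤deg U u T) degT≤1))
      where
      degT≤1 : deg T u ≤ 1ℤ
      degT≤1 = ℤ.≤-trans (deg-⊆ u (⊆-trans T⊆ ∖⊆)) deg≤1
      cases : count (U ∩ adj u) T ≡ 0ℤ ⊎ count (U ∩ adj u) T ≡ 1ℤ →
              0ℤ < Γ U κ T - N * count (U ∩ adj u) T
      cases (inj₁ c) = 0<-resp (trans (cong (λ c → Γ U κ T - N * c) c) (lemma (Γ U κ T) N))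
        (pos (⊆-trans T⊆ ∖⊆) ne)
        where
        lemma : ∀ g N → g - N * 0ℤ ≡ g
        lemma = solve-∀
      cases (inj₂ c) = 0<-resp (trans (cong (λ c → Γ U κ T - N * c) c) (lemma (Γ U κ T) N (κ u)))
          (0<+ (0<-resp (sym (trans (Γ-insert∈ U κ u∈U (u∉ T⊆))
            (cong (λ d → κ u + N + Γ U κ T - + 2 * (N * d)) d≡1)))
                  (Γ-insert-pos pos (U⊆V u∈U) T⊆))
               (≤⇒0≤ κu≤0))
        where
        d≡1 : deg T u ≡ 1ℤ
        d≡1 = ℤ.≤-antisym degT≤1 (subst (_≤ deg T u) c (count-adj≤deg U u T))
        lemma : ∀ g N k → g - N * 1ℤ ≡ (k + N + g - + 2 * (N * 1ℤ)) + (0ℤ - k)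
        lemma = solve-∀

    -- A neighbour of `u` in `S` is already decided, so at most one neighbour loses credit, and it
    -- lies in `T ∖ S`. In that case positivity is compared with that of `u` together with
    -- `(T ∖ S) ∪ S`: there `u` has at least two neighbours, and the small potential of `S` makes up
    -- exactly the difference.
    forcedByForest : ∀ {V U κ u S} → U ⊆ V → u ∈ U → deg V u ≤ + 2 →
      Positive V U κ →
      S ⊆ V ∖ ⁅ u ⁆ → 1ℤ ≤ deg S u → Γ U κ S ≤ + 2 * N - κ u → (∀ {v} → v ∈ S → v ∉ U) →
      ∀ {T} → T ⊆ V ∖ ⁅ u ⁆ → Nonempty T → 0ℤ < Γ U κ T - N * count (U ∩ adj u) T
    forcedByForest {V} {U} {κ} {u} {S} U⊆V u∈U deg≤2 pos S⊆ 1≤degS ΓS≤ S∩U {T} T⊆ ne =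
      cases (≤1⇒≡ (0≤count (U ∩ adj u) T) (ℤ.≤-trans c≤degT′ degT′≤1))
      where
      T′ = T ∖ S
      R = T′ ∪ S
      R≐ : R ≐ T′ ⊎ S
      R≐ = ∪-≐ λ v∈ → proj₂ (∈∖⁻ v∈)
      R⊆ : R ⊆ V ∖ ⁅ u ⁆
      R⊆ v∈ = [ (λ v∈T′ → T⊆ (∖⊆ v∈T′)) , S⊆ ]′ (∈∪⁻ v∈)
      degR : deg R u ≡ deg T′ u + deg S u
      degR = lin-≐ (𝟙 ∘ adj u) R≐
      degT′≤1 : deg T′ u ≤ 1ℤ
      degT′≤1 = 0≤⇒≤ (0≤-resp (lemma (deg T′ u) (deg S u))
          (0≤+ (≤⇒0≤ (ℤ.≤-trans (ℤ.≤-reflexive (sym degR))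
            (ℤ.≤-trans (deg-⊆ u (⊆-trans R⊆ ∖⊆)) deg≤2))) (≤⇒0≤ 1≤degS)))
        where
        lemma : ∀ a b → 1ℤ - a ≡ (+ 2 - (a + b)) + (b - 1ℤ)
        lemma = solve-∀
      c≡ : count (U ∩ adj u) T ≡ count (U ∩ adj u) T′
      c≡ = trans (lin-≐ (𝟙 ∘ (U ∩ adj u)) (∩∖-≐ T S))
        (trans (cong (_+ count (U ∩ adj u) T′) c≡0) (ℤ.+-identityˡ (count (U ∩ adj u) T′)))
        where
        c≡0 : count (U ∩ adj u) (T ∩ S) ≡ 0ℤ
        c≡0 = ℤ.≤-antisym (ℤ.≤-trans (lin-mono {c′ = λ _ → 0ℤ} λ v∈ → ℤ.≤-reflexive
                (∉⇒𝟙≡0 λ v∈U → S∩U (proj₂ (∈∩⁻ v∈)) (proj₁ (∈∩⁻ v∈U))))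
                  (ℤ.≤-reflexive (lin-0 (T ∩ S))))
                (0≤count (U ∩ adj u) (T ∩ S))
      c≤degT′ : count (U ∩ adj u) T ≤ deg T′ u
      c≤degT′ = ℤ.≤-trans (ℤ.≤-reflexive c≡) (count-adj≤deg U u T′)
      cases : count (U ∩ adj u) T ≡ 0ℤ ⊎ count (U ∩ adj u) T ≡ 1ℤ →
              0ℤ < Γ U κ T - N * count (U ∩ adj u) T
      cases (inj₁ c) = 0<-resp (trans (cong (λ c → Γ U κ T - N * c) c) (lemma (Γ U κ T) N))
        (pos (⊆-trans T⊆ ∖⊆) ne)
        where
        lemma : ∀ g N → g - N * 0ℤ ≡ g
        lemma = solve-∀
      cases (inj₂ c) = 0<-resp
          (trans (cong (λ c → Γ U κ T - N * c) c)
          (trans (cong (λ g → g - N * 1ℤ)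
            (trans (Γ-≐ U κ (∩∖-≐ T S))
              (cong (λ e → Γ U κ (T ∩ S) + Γ U κ T′ - + 2 * (N * e)) (edges-sym (T ∩ S) T′))))
          (trans (lemma N (κ u) (Γ U κ (T ∩ S)) (Γ U κ T′) (Γ U κ S) (edges T′ (T ∩ S))
            (edges T′ S) (deg R u))
                 (cong (λ z → κ u + N + z - + 2 * (N * deg R u) + rest) (sym (Γ-≐ U κ R≐))))))
          (0<+ (0<-resp (sym (Γ-insert∈ U κ u∈U (u∉ R⊆))) (Γ-insert-pos pos (U⊆V u∈U) R⊆))
            (0≤+ (0≤+ (0≤+ (≤⇒0≤ ΓS≤) (Γ-nonneg pos λ v∈ → ∖⊆ (T⊆ (proj₁ (∈∩⁻ v∈)))))
                      (0≤* 0≤2N (≤⇒0≤ e≤)))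
                 (0≤* 0≤2N (≤⇒0≤ 2≤degR))))
        where
        rest = (+ 2 * N - κ u - Γ U κ S) + Γ U κ (T ∩ S) + + 2 * N *
          (edges T′ S - edges T′ (T ∩ S)) + + 2 * N * (deg R u - + 2)
        e≤ : edges T′ (T ∩ S) ≤ edges T′ S
        e≤ = lin-mono λ {v} _ → deg-⊆ v λ w∈ → proj₂ (∈∩⁻ w∈)
        2≤degR : + 2 ≤ deg R u
        2≤degR = ℤ.≤-trans (ℤ.+-mono-≤ (subst (_≤ deg T′ u) c c≤degT′) 1≤degS)
          (ℤ.≤-reflexive (sym degR))
        lemma : ∀ N k p q s e f d → p + q - + 2 * (N * e) - N * 1ℤ ≡
          k + N + (q + s - + 2 * (N * f)) - + 2 * (N * d) +
          ((+ 2 * N - k - s) + p + + 2 * N * (f - e) + + 2 * N * (d - + 2))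
        lemma = solve-∀

    -- Blocking sets of minimum potential

    near : Sub → Sub
    near S v = does (1ℤ ℤ.≤? deg S v)

    ∈near⁺ : ∀ {S v} → 1ℤ ≤ deg S v → v ∈ near S
    ∈near⁺ {S} {v} 1≤d = mem (dec-true (1ℤ ℤ.≤? deg S v) 1≤d)

    ∈near⁻ : ∀ {S v} → v ∈ near S → 1ℤ ≤ deg S v
    ∈near⁻ {S} {v} (mem eq) = does⇒ (1ℤ ℤ.≤? deg S v) eq

    -- S minimises Γ U κ among the sets that avoid u and contain a neighbour x of u, and
    -- its potential δ is less than N. S is decided first, with κ x lowered by δ − 1.
    module Tight {V U : Sub} {κ : Fin n → ℤ} {u : Fin n} {S : Sub}
      (U⊆V : U ⊆ V) (u∈U : u ∈ U) (pos : Positive V U κ) (S⊆ : S ⊆ V ∖ ⁅ u ⁆)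
      (1≤degS : 1ℤ ≤ deg S u) (δ<N : Γ U κ S < N)
      (min : ∀ {T} → T ⊆ V ∖ ⁅ u ⁆ → 1ℤ ≤ deg T u → Γ U κ S ≤ Γ U κ T) where

      δ : ℤ
      δ = Γ U κ S

      neighbour : ∃[ x ] x ∈ S × x ∈ adj u
      neighbour = 1≤deg⇒adj 1≤degS

      x = proj₁ neighbour
      x∈S = proj₁ (proj₂ neighbour)
      ux = proj₂ (proj₂ neighbour)

      S⊆V : S ⊆ V
      S⊆V = ⊆-trans S⊆ ∖⊆

      0<δ : 0ℤ < δ
      0<δ = pos S⊆V (x , x∈S)

      -- A subset of `S` containing `x` has potential at least `δ` by minimality, with equality for
      -- `S`. So `δ - 1` is the largest decrease at `x` that keeps all of them positive.
      κ₁ : Fin n → ℤ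
      κ₁ v = κ v + - (δ - 1ℤ) * 𝟙 (⁅ x ⁆ v)

      0≤δ-1 : 0ℤ ≤ δ - 1ℤ
      0≤δ-1 = 0<⇒0≤-1 refl 0<δ

      κ₁≤κ : ∀ v → κ₁ v ≤ κ v
      κ₁≤κ v = 0≤⇒≤ (0≤-resp (lemma (κ v) (δ - 1ℤ) (𝟙 (⁅ x ⁆ v))) (0≤* 0≤δ-1 (0≤𝟙 (⁅ x ⁆ v))))
        where
        lemma : ∀ k d t → k - (k + - d * t) ≡ d * t
        lemma = solve-∀

      Φ-κ₁ : ∀ T → Φ κ₁ T ≡ Φ κ T + - (δ - 1ℤ) * 𝟙 (T x)
      Φ-κ₁ T = trans (Φ-shift κ (- (δ - 1ℤ)) (𝟙 ∘ ⁅ x ⁆) T)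
        (cong (λ c → Φ κ T + - (δ - 1ℤ) * c) (trans (count-sym ⁅ x ⁆ T) (lin-⁅⁆ (𝟙 ∘ T) x)))

      Φ-κ₁∈ : ∀ {T} → x ∈ T → Φ κ₁ T ≡ Φ κ T - δ + 1ℤ
      Φ-κ₁∈ {T} x∈T = trans (Φ-κ₁ T)
        (trans (cong (λ c → Φ κ T + - (δ - 1ℤ) * c) (∈⇒𝟙≡1 x∈T)) (lemma (Φ κ T) δ))
        where
        lemma : ∀ f d → f + - (d - 1ℤ) * 1ℤ ≡ f - d + 1ℤ
        lemma = solve-∀

      Φ-κ₁∉ : ∀ {T} → x ∉ T → Φ κ₁ T ≡ Φ κ T
      Φ-κ₁∉ {T} x∉T = trans (Φ-κ₁ T)
        (trans (cong (λ c → Φ κ T + - (δ - 1ℤ) * c) (∉⇒𝟙≡0 x∉T)) (lemma (Φ κ T) δ))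
        where
        lemma : ∀ f d → f + - (d - 1ℤ) * 0ℤ ≡ f
        lemma = solve-∀

      positive₁ : Positive S (U ∩ S) κ₁
      positive₁ {T} T⊆S ne = 0<-resp (cong (λ c → Φ κ₁ T + N * c) (lin-≡ count≡)) (cases (x ∈? T))
        where
        count≡ : ∀ {v} → v ∈ T → 𝟙 ((U ∩ S) v) ≡ 𝟙 (U v)
        count≡ v∈T = ℤ.≤-antisym (𝟙-mono λ v∈ → proj₁ (∈∩⁻ v∈)) (𝟙-mono λ v∈U → ∈∩⁺ v∈U (T⊆S v∈T))
        cases : Dec (x ∈ T) → 0ℤ < Φ κ₁ T + N * count U T
        cases (yes x∈T) = 0<-resp
          (trans (cong (_+ N * count U T) (Φ-κ₁∈ x∈T)) (lemma (Φ κ T) δ (N * count U T)))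
            (0<+ (+<+ (s≤s z≤n)) (≤⇒0≤ (min (⊆-trans T⊆S S⊆) (adj⇒1≤deg x∈T ux))))
          where
          lemma : ∀ f d c → f - d + 1ℤ + c ≡ 1ℤ + (f + c - d)
          lemma = solve-∀
        cases (no x∉T) = 0<-resp (cong (_+ N * count U T) (Φ-κ₁∉ x∉T)) (pos (⊆-trans T⊆S S⊆V) ne)

      module Second (s : Solution S (U ∩ S) κ₁) where
        open Solution s using (I; I⊆U; indep)

        I⊆S : I ⊆ S
        I⊆S v∈I = proj₂ (∈∩⁻ (I⊆U v∈I))

        -- All of `S` is now decided, and a vertex next to `I` can no longer become independent.
        U₂ : Sub
        U₂ = U ∖ S ∖ near I

        -- `T` is compared with `W`, in which `T₁` is replaced by all of `S`. Undoing the
        -- replacement frees the edges from `I` and `R` to `T₂`. Each of the `b` vertices that lose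
        -- their credit `N` has an edge to `I` worth `2N`, so there is a surplus of `N * b`.
        positive₂ : Positive (V ∖ I) U₂ κ
        positive₂ {T} T⊆ ne = go (u ∈? T) (x ∈? T₁) (x ∈? I) (nonempty? T₁) (0ℤ ℤ.<? b)
          where
          T₁ = T ∩ S
          T₂ = T ∖ S
          W  = S ∪ T₂
          R  = S ∖ I ∖ T₁
          b  = count ((U ∖ S) ∩ near I) T₂
          c₁ = count U₂ T₁

          T₂⊆V : T₂ ⊆ V
          T₂⊆V v∈ = ∖⊆ (T⊆ (∖⊆ v∈))

          T₁⊆ : T₁ ⊆ S ∖ I
          T₁⊆ v∈ = let v∈T , v∈S = ∈∩⁻ v∈ in ∈∖⁺ v∈S (proj₂ (∈∖⁻ (T⊆ v∈T)))

          W≐ : W ≐ S ⊎ T₂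
          W≐ = ∪-≐ λ v∈S v∈ → proj₂ (∈∖⁻ v∈) v∈S

          Γ₂ : Γ U₂ κ T₂ ≡ Γ U κ T₂ - N * b
          Γ₂ = trans (lemma (Φ κ T₂) N (count U₂ T₂) b)
            (cong (λ c → Φ κ T₂ + N * c - N * b) (trans (sym (count-≐ T₂ (∩∖-≐ (U ∖ S) (near I))))
               (count-∖ λ v∈ → proj₂ (∈∖⁻ v∈))))
            where
            lemma : ∀ f N c b → f + N * c ≡ f + N * (b + c) - N * b
            lemma = solve-∀

          ΓT : Γ U₂ κ T ≡ Φ κ T₁ + N * c₁ + (Γ U κ T₂ - N * b) - + 2 * (N * edges T₁ T₂)
          ΓT = trans (Γ-≐ U₂ κ (∩∖-≐ T S))
            (cong (λ g → Φ κ T₁ + N * c₁ + g - + 2 * (N * edges T₁ T₂)) Γ₂)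

          edgesS : edges S T₂ ≡ edges I T₂ + (edges T₁ T₂ + edges R T₂)
          edgesS = trans (edges-≐ˡ T₂ (∖-≐ I⊆S))
            (cong (λ e → edges I T₂ + e) (edges-≐ˡ T₂ (∖-≐ T₁⊆)))

          rest : ℤ
          rest = N * c₁ + + 2 * N * (edges I T₂ - b)

          0≤rest : 0ℤ ≤ rest
          0≤rest = 0≤+ (0≤* 0≤N (0≤count U₂ T₁)) (0≤* 0≤2N (≤⇒0≤ b≤))
            where
            b≤ : b ≤ edges I T₂
            b≤ = ℤ.≤-trans (lin-mono λ {v} _ → 𝟙≤deg v) (ℤ.≤-reflexive (edges-sym T₂ I))
              where
              𝟙≤deg : ∀ v → 𝟙 (((U ∖ S) ∩ near I) v) ≤ deg I v
              𝟙≤deg v with v ∈? ((U ∖ S) ∩ near I)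
              ... | yes v∈ = ℤ.≤-trans (ℤ.≤-reflexive (∈⇒𝟙≡1 v∈)) (∈near⁻ (proj₂ (∈∩⁻ v∈)))
              ... | no  v∉ = ℤ.≤-trans (ℤ.≤-reflexive (∉⇒𝟙≡0 v∉)) (0≤deg I v)

          -- Γ U κ W ≥ δ if u ∉ T, by the choice of S. If u ∈ T, the missing δ is supplied by the edge
          -- between u and x: by Φ κ T₁ if x ∈ T₁, by N * b if x ∈ I, and by edges R T₂ otherwise.
          ΓT′ : Γ U₂ κ T ≡ Φ κ T₁ + (Γ U κ W - δ) + N * b + + 2 * N * edges R T₂ + rest
          ΓT′ = trans ΓT (trans
            (lemma (Φ κ T₁) (N * c₁) N δ (Γ U κ T₂) b (edges I T₂) (edges T₁ T₂) (edges R T₂))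
            (cong (λ w → Φ κ T₁ + (w - δ) + N * b + + 2 * N * edges R T₂ + rest)
              (sym (trans (Γ-≐ U κ W≐) (cong (λ e → δ + Γ U κ T₂ - + 2 * (N * e)) edgesS)))))
            where
            lemma : ∀ f c N d g b i t r → f + c + (g - N * b) - + 2 * (N * t) ≡
              f + (d + g - + 2 * (N * (i + (t + r))) - d) + N * b + + 2 * N * r +
                (c + + 2 * N * (i - b))
            lemma = solve-∀

          0≤ΦT₁ : 0ℤ ≤ Φ κ T₁
          0≤ΦT₁ with nonempty? T₁
          ... | yes ne₁ = ℤ.<⇒≤ (ℤ.<-≤-trans (Solution.pos s T₁⊆ ne₁) (Φ-mono T₁ κ₁≤κ))
          ... | no  ∅   = 0≤-resp (Φ-empty κ ∅) ℤ.≤-refl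

          0≤Nb : 0ℤ ≤ N * b
          0≤Nb = 0≤* 0≤N (0≤count ((U ∖ S) ∩ near I) T₂)

          0≤2NR : 0ℤ ≤ + 2 * N * edges R T₂
          0≤2NR = 0≤* 0≤2N (0≤edges R T₂)

          0<ΓW : u ∈ T → 0ℤ < Γ U κ W
          0<ΓW u∈T = pos (λ v∈ → [ S⊆V , T₂⊆V ]′ (∈∪⁻ v∈)) (x , ∈∪⁺ˡ x∈S)

          0≤ΓW-δ : u ∉ T → 0ℤ ≤ Γ U κ W - δ
          0≤ΓW-δ u∉T = ≤⇒0≤ (min (λ v∈ → [ S⊆ , (λ v∈T₂ → ∈∖⁺ (T₂⊆V v∈T₂)
              (λ v∈u → u∉T (subst (_∈ T) (sym (∈⁅⁆⁻ v∈u)) (∖⊆ v∈T₂)))) ]′ (∈∪⁻ v∈))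
            (adj⇒1≤deg (∈∪⁺ˡ x∈S) ux))

          u∈T₂ : u ∈ T → u ∈ T₂
          u∈T₂ u∈T = ∈∖⁺ u∈T (u∉ S⊆)

          go : Dec (u ∈ T) → Dec (x ∈ T₁) → Dec (x ∈ I) → Dec (Nonempty T₁) → Dec (0ℤ < b) →
               0ℤ < Γ U₂ κ T
          -- If `u ∉ T`, every summand of `ΓT′` is nonnegative, and strictness comes from `Φ κ T₁`
          -- or from `N * b`. If `T₁` is empty and `b` is 0, the potential is just `Γ U κ T₂`.
          go (no u∉T) _ _ (yes ne₁) _ = 0<-resp ΓT′
            (0<+ (0<+ (0<+ (0<+ (ℤ.<-≤-trans (Solution.pos s T₁⊆ ne₁) (Φ-mono T₁ κ₁≤κ))
              (0≤ΓW-δ u∉T)) 0≤Nb) 0≤2NR) 0≤rest)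
          go (no u∉T) _ _ (no _) (yes 0<b) = 0<-resp ΓT′
            (0<+ (0<+ (ℤ.+-mono-≤-< (0≤+ 0≤ΦT₁ (0≤ΓW-δ u∉T)) (0<* 0<N 0<b)) 0≤2NR) 0≤rest)
          go (no u∉T) _ _ (no ∅) (no b≯0) = 0<-resp (trans ΓT (trans
              (cong₂ (λ p q → p + N * c₁ + (Γ U κ T₂ - N * q) - + 2 * (N * edges T₁ T₂))
                (Φ-empty κ ∅)
                (ℤ.≤-antisym (ℤ.≮⇒≥ b≯0) (0≤count ((U ∖ S) ∩ near I) T₂)))
              (trans (cong₂ (λ p q → 0ℤ + N * p + (Γ U κ T₂ - N * 0ℤ) - + 2 * (N * q))
                (lin-empty (𝟙 ∘ U₂) ∅) (lin-empty (deg T₂) ∅))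
                (lemma N (Γ U κ T₂)))))
              (pos T₂⊆V ne₂)
            where
            lemma : ∀ N g → 0ℤ + N * 0ℤ + (g - N * 0ℤ) - + 2 * (N * 0ℤ) ≡ g
            lemma = solve-∀
            ne₂ : Nonempty T₂
            ne₂ = let v , v∈T = ne in v , ∈∖⁺ v∈T λ v∈S → ∅ (v , ∈∩⁺ v∈T v∈S)
          go (yes u∈T) (yes x∈T₁) _ _ _ =
            0<-resp (trans ΓT′ (lemma (Φ κ T₁) (Γ U κ W) δ (N * b) (+ 2 * N * edges R T₂) rest))
              (0<+ (0<+ (0<+ (0<+ (0<ΓW u∈T) 0≤Φ-δ) 0≤Nb) 0≤2NR) 0≤rest)
            where
            lemma : ∀ f w d b r q → f + (w - d) + b + r + q ≡ w + (f - d) + b + r + q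
            lemma = solve-∀
            -- The solution on `S` gives `Φ κ T₁ - δ + 1 > 0`; this is what the lowered weight at
            -- `x` was for.
            0≤Φ-δ : 0ℤ ≤ Φ κ T₁ - δ
            0≤Φ-δ = 0<⇒0≤-1 (trans (lemma′ (Φ κ T₁) δ) (cong (_- 1ℤ) (sym (Φ-κ₁∈ x∈T₁))))
              (Solution.pos s T₁⊆ (x , x∈T₁))
              where
              lemma′ : ∀ f d → f - d ≡ f - d + 1ℤ - 1ℤ
              lemma′ = solve-∀
          go (yes u∈T) (no x∉T₁) (yes x∈I) _ _ =
              0<-resp (trans ΓT′ (lemma (Φ κ T₁) (Γ U κ W) δ N b (+ 2 * N * edges R T₂) rest))
              (0<+ (0<+ (0<+ (0<+ (0<+ (0<ΓW u∈T) 0≤ΦT₁) (ℤ.<⇒≤ (<⇒0< δ<N)))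
                (0≤* 0≤N (≤⇒0≤ 1≤b))) 0≤2NR) 0≤rest)
            where
            lemma : ∀ f w d N b r q → f + (w - d) + N * b + r + q ≡
                    w + f + (N - d) + N * (b - 1ℤ) + r + q
            lemma = solve-∀
            u∈near : u ∈ (U ∖ S) ∩ near I
            u∈near = ∈∩⁺ (∈∖⁺ u∈U (u∉ S⊆)) (∈near⁺ (adj⇒1≤deg x∈I ux))
            1≤b : 1ℤ ≤ b
            1≤b = begin
              1ℤ ≡⟨ ∈⇒𝟙≡1 u∈near ⟨
              𝟙 (((U ∖ S) ∩ near I) u) ≡⟨ lin-⁅⁆ (𝟙 ∘ ((U ∖ S) ∩ near I)) u ⟨
              count ((U ∖ S) ∩ near I) ⁅ u ⁆ ≤⟨ lin-⊆ (λ v → 0≤𝟙 (((U ∖ S) ∩ near I) v))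
                (∈⇒⁅⁆⊆ (u∈T₂ u∈T)) ⟩
              b ∎
              where open ≤-Reasoning
          go (yes u∈T) (no x∉T₁) (no x∉I) _ _ =
              0<-resp (trans ΓT′ (lemma (Φ κ T₁) (Γ U κ W) δ N (N * b) (edges R T₂) rest))
              (0<+ (0<+ (0<+ (0<+ (0<+ (0<+ (0<ΓW u∈T) 0≤ΦT₁) (ℤ.<⇒≤ (<⇒0< δ<N))) 0≤N) 0≤Nb)
                (0≤* 0≤2N (≤⇒0≤ 1≤R))) 0≤rest)
            where
            lemma : ∀ f w d N b r q → f + (w - d) + b + + 2 * N * r + q ≡
                    w + f + (N - d) + N + b + + 2 * N * (r - 1ℤ) + q
            lemma = solve-∀
            x∈R : x ∈ R
            x∈R = ∈∖⁺ (∈∖⁺ x∈S x∉I) x∉T₁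
            1≤R : 1ℤ ≤ edges R T₂
            1≤R = begin
              1ℤ              ≤⟨ adj⇒1≤deg (u∈T₂ u∈T) (adj-swap ux) ⟩
              deg T₂ x        ≡⟨ lin-⁅⁆ (deg T₂) x ⟨
              edges ⁅ x ⁆ T₂  ≤⟨ lin-⊆ (0≤deg T₂) (∈⇒⁅⁆⊆ x∈R) ⟩
              edges R T₂      ∎
              where open ≤-Reasoning

        -- The second instance lives on `V ∖ I` and not only on `V ∖ S`, so its `pos` already covers
        -- sets that meet `S`. Independence across the two parts holds because `U₂` avoids `near I`.
        combine : Solution (V ∖ I) U₂ κ → Solution V U κ
        combine s₂ = record
          { I     = I ∪ I₂
          ; I⊆U   = λ v∈ → [ (λ v∈I → proj₁ (∈∩⁻ (I⊆U v∈I))) ,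
            (λ v∈I₂ → ∖⊆ (∖⊆ (Solution.I⊆U s₂ v∈I₂))) ]′ (∈∪⁻ v∈)
          ; indep = λ a∈ b∈ → indep′ (∈∪⁻ a∈) (∈∪⁻ b∈)
          ; pos   = λ T⊆ → Solution.pos s₂ λ v∈T → let v∈V , v∉ = ∈∖⁻ (T⊆ v∈T) in
                      ∈∖⁺ (∈∖⁺ v∈V (v∉ ∘ ∈∪⁺ˡ)) (v∉ ∘ ∈∪⁺ʳ)
          }
          where
          I₂ = Solution.I s₂
          cross : ∀ {a b} → a ∈ I → b ∈ I₂ → a ∉ adj b
          cross a∈ b∈ ba = proj₂ (∈∖⁻ (Solution.I⊆U s₂ b∈)) (∈near⁺ (adj⇒1≤deg a∈ ba))
          indep′ : ∀ {a b} → a ∈ I ⊎ a ∈ I₂ → b ∈ I ⊎ b ∈ I₂ → b ∉ adj a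
          indep′ (inj₁ a∈) (inj₁ b∈) = indep a∈ b∈
          indep′ (inj₁ a∈) (inj₂ b∈) = cross a∈ b∈ ∘ adj-swap
          indep′ (inj₂ a∈) (inj₁ b∈) = cross b∈ a∈
          indep′ (inj₂ a∈) (inj₂ b∈) = Solution.indep s₂ a∈ b∈

    -- The induction

    measure : Sub → Sub → ℤ
    measure V U = size V + size U

    Touches : Sub → Fin n → Sub → Set
    Touches V u T = T ⊆ V ∖ ⁅ u ⁆ × 1ℤ ≤ deg T u

    touches? : ∀ V u T → Dec (Touches V u T)
    touches? V u T = (T ⊆? (V ∖ ⁅ u ⁆)) ×-dec (1ℤ ℤ.≤? deg T u)

    touches-resp : ∀ {V u S T} → (∀ v → S v ≡ T v) → Touches V u S → Touches V u T
    touches-resp {V} {u} {S} {T} S≗T (S⊆ , 1≤d) =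
      (λ {v} (mem v∈) → S⊆ (mem (trans (S≗T v) v∈))) , subst (1ℤ ≤_) (lin-cong (𝟙 ∘ adj u) S≗T) 1≤d

    Γ-cong : ∀ U κ {S T} → (∀ v → S v ≡ T v) → Γ U κ S ≡ Γ U κ T
    Γ-cong U κ S≗T = cong₂ (λ a b → a + N * b) (Φ-cong κ S≗T) (lin-cong (𝟙 ∘ U) S≗T)

    N*<2N⇒≤1 : ∀ {a k} → N * a < k → k ≤ + 2 * N → a ≤ 1ℤ
    N*<2N⇒≤1 {a} p q = 0≤⇒≤ (0<⇒0≤-1 (lemma a) (<⇒0< (N*-cancel-< {a} {+ 2}
        (ℤ.<-≤-trans p (ℤ.≤-trans q (ℤ.≤-reflexive (ℤ.*-comm (+ 2) N)))))))
      where
      lemma : ∀ a → 1ℤ - a ≡ + 2 - a - 1ℤ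
      lemma = solve-∀

    N*<3N⇒≤2 : ∀ {a k} → N * a < k + N → k ≤ + 2 * N → a ≤ + 2
    N*<3N⇒≤2 {a} p q = 0≤⇒≤ (0<⇒0≤-1 (lemma a) (<⇒0< (N*-cancel-< {a} {+ 3}
        (ℤ.<-≤-trans p (ℤ.≤-trans (ℤ.+-monoˡ-≤ N q) (ℤ.≤-reflexive (lemma′ N)))))))
      where
      lemma : ∀ a → + 2 - a ≡ + 3 - a - 1ℤ
      lemma = solve-∀
      lemma′ : ∀ N → + 2 * N + N ≡ N * + 3
      lemma′ = solve-∀

    -- `Γ U κ` is `Φ` for the weights `κ v + N * 𝟙 (U v)`, so averaging over `V` applies.
    sparseVertex : ∀ {V U κ} → Positive V U κ → Nonempty V →
                   ∃[ u ] u ∈ V × N * deg V u < κ u + N * 𝟙 (U u)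
    sparseVertex {V} {U} {κ} pos ne = Φ-pos⇒∃ {λ v → κ v + N * 𝟙 (U v)}
      (0<-resp (Φ-shift κ N (𝟙 ∘ U) V) (pos (λ v∈ → v∈) ne))

    Smaller : Sub → Sub → Sub → Sub → Set
    Smaller V′ U′ V U = 1ℤ + measure V′ U′ ≤ measure V U

    smallerˡ : ∀ {V′ U′ V U u} → u ∈ V → V′ ⊆ V ∖ ⁅ u ⁆ → U′ ⊆ U → Smaller V′ U′ V U
    smallerˡ {V′} {U′} {V} {U} {u} u∈V V′⊆ U′⊆ = begin
      1ℤ + (size V′ + size U′)          ≡⟨ ℤ.+-assoc 1ℤ (size V′) (size U′) ⟨
      1ℤ + size V′ + size U′            ≤⟨ ℤ.+-mono-≤ (ℤ.+-monoʳ-≤ 1ℤ (size-⊆ V′⊆)) (size-⊆ U′⊆) ⟩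
      1ℤ + size (V ∖ ⁅ u ⁆) + size U   ≡⟨ cong (_+ size U) (size-∖⁅⁆ u∈V) ⟨
      size V + size U                   ∎
      where open ≤-Reasoning

    smallerʳ : ∀ {V′ U′ V U u} → u ∈ U → V′ ⊆ V → U′ ⊆ U ∖ ⁅ u ⁆ → Smaller V′ U′ V U
    smallerʳ {V′} {U′} {V} {U} u∈U V′⊆ U′⊆ =
      subst₂ _≤_ (cong (λ m → 1ℤ + m) (ℤ.+-comm (size U′) (size V′))) (ℤ.+-comm (size U) (size V))
        (smallerˡ {V = U} {U = V} u∈U U′⊆ V′⊆)

    -- The bound `k` on the measure makes the recursion structural. The condition `κ v ≤ 2N`
    -- survives because weights are only ever lowered.
    solution : ∀ k {V U κ} → measure V U ≤ + k → U ⊆ V → (∀ v → κ v ≤ + 2 * N) →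
               Positive V U κ → Solution V U κ
    solution k {V} {U} {κ} m≤k U⊆V κ≤ pos with nonempty? V
    ... | no ∅ = record
      { I     = U
      ; I⊆U   = λ v∈ → v∈
      ; indep = λ v∈ → contradiction (_ , U⊆V v∈) ∅
      ; pos   = λ T⊆ (v , v∈) → contradiction (v , ∖⊆ (T⊆ v∈)) ∅
      }
    ... | yes ne with k
    ...   | zero = contradiction m≤k (ℤ.<⇒≱ (0<+ (0<size ne) (lin-nonneg λ _ → +≤+ z≤n)))
      where
      0<size : Nonempty V → 0ℤ < size V
      0<size (v , v∈) = subst (0ℤ <_) (sym (size-∖⁅⁆ v∈))
        (0<+ {1ℤ} (+<+ (s≤s z≤n)) (lin-nonneg λ _ → +≤+ z≤n))
    ...   | suc k′ = reduce (sparseVertex pos ne)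
      where
      measure≤ : ∀ {V′ U′} → Smaller V′ U′ V U → measure V′ U′ ≤ + k′
      measure≤ {V′} {U′} smaller =
        0≤⇒≤ (0≤-resp (lemma (measure V′ U′) (+ k′)) (≤⇒0≤ (ℤ.≤-trans smaller m≤k)))
        where
        lemma : ∀ m k → k - m ≡ (1ℤ + k) - (1ℤ + m)
        lemma = solve-∀

      recurse : ∀ {V′ U′ κ′} → Smaller V′ U′ V U → U′ ⊆ V′ → (∀ v → κ′ v ≤ + 2 * N) →
                Positive V′ U′ κ′ × (Solution V′ U′ κ′ → Solution V U κ) → Solution V U κ
      recurse smaller U′⊆V′ κ′≤ (pos′ , extend) =
        extend (solution k′ (measure≤ smaller) U′⊆V′ κ′≤ pos′)

      ∖-mono : ∀ {S T R} → S ⊆ T → S ∖ R ⊆ T ∖ R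
      ∖-mono S⊆T v∈ = let v∈S , v∉R = ∈∖⁻ v∈ in ∈∖⁺ (S⊆T v∈S) v∉R

      id⊆ : ∀ {S} → S ⊆ S
      id⊆ v∈ = v∈

      lower≤′ : ∀ {u} v → lower κ u v ≤ + 2 * N
      lower≤′ {u} v = ℤ.≤-trans (lower≤ {κ} (κ≤ u) v) (κ≤ v)

      independent : ∀ {u} → u ∈ U →
        (∀ {T} → T ⊆ V ∖ ⁅ u ⁆ → Nonempty T → 0ℤ < Γ U κ T - N * count (U ∩ adj u) T) →
        Solution V U κ
      independent u∈U h = recurse (smallerˡ (U⊆V u∈U) id⊆ (⊆-trans ∖⊆ ∖⊆))
        (∖-mono (⊆-trans ∖⊆ U⊆V)) κ≤
        (chooseIndependent u∈U h)

      tight : ∀ {u S} → u ∈ U → deg V u ≤ + 2 → N < κ u → Touches V u S → Γ U κ S ≤ + 2 * N - κ u →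
              (∀ {T} → Touches V u T → Γ U κ S ≤ Γ U κ T) → Solution V U κ
      tight {u} {S} u∈U deg≤2 N<κu (S⊆ , 1≤d) δ≤r min with nonempty? (U ∩ S)
      ... | no ∅ = independent u∈U
        (forcedByForest U⊆V u∈U deg≤2 pos S⊆ 1≤d δ≤r λ v∈S v∈U → ∅ (_ , ∈∩⁺ v∈U v∈S))
      -- `I` may be empty, so `V ∖ I` need not be smaller than `V`; the measure drops because the
      -- undecided vertex `y` of `S` leaves `U`. The instance on `S` is smaller because `S` misses
      -- `u`.
      ... | yes (y , y∈) = recurse
          (smallerʳ (proj₁ (∈∩⁻ y∈)) ∖⊆ λ v∈ → let v∈U , v∉S = ∈∖⁻ (∖⊆ v∈) in
             ∈∖⁺ v∈U λ v∈y → v∉S (∈⇒⁅⁆⊆ (proj₂ (∈∩⁻ y∈)) v∈y))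
          (λ v∈ → let v∈U , v∉S = ∈∖⁻ (∖⊆ v∈) in ∈∖⁺ (U⊆V v∈U) (v∉S ∘ I⊆S))
          κ≤ (positive₂ , combine)
        where
        δ<N : Γ U κ S < N
        δ<N = ℤ.≤-<-trans δ≤r (0<⇒< (0<-resp (lemma N (κ u)) (<⇒0< N<κu)))
          where
          lemma : ∀ N k → N - (+ 2 * N - k) ≡ k - N
          lemma = solve-∀
        open Tight U⊆V u∈U pos S⊆ 1≤d δ<N (λ T⊆ 1≤d′ → min (T⊆ , 1≤d′))
        s₁ : Solution S (U ∩ S) κ₁
        s₁ = solution k′ (measure≤ (smallerˡ (U⊆V u∈U) S⊆ λ v∈ → proj₁ (∈∩⁻ v∈)))
          (λ v∈ → proj₂ (∈∩⁻ v∈)) (λ v → ℤ.≤-trans (κ₁≤κ v) (κ≤ v)) positive₁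
        open Second s₁

      degreeTwo : ∀ {u} → u ∈ U → deg V u ≤ + 2 → N < κ u → Solution V U κ
      degreeTwo {u} u∈U deg≤2 N<κu
        -- A set found here is exactly an obstruction to the assumption `big` of `addDegreeTwo`.
        with search (λ T → touches? V u T ×-dec (Γ U κ T ℤ.≤? + 2 * N - κ u))
        (λ S≗T (nr , le) → touches-resp S≗T nr , subst (_≤ + 2 * N - κ u) (Γ-cong U κ S≗T) le)
      ... | no ∄ = recurse (smallerˡ (U⊆V u∈U) id⊆ ∖⊆) (∖-mono U⊆V) lower≤′
              (addDegreeTwo U⊆V u∈U N<κu (κ≤ u) deg≤2 pos
                λ T⊆ 1≤d → ℤ.≰⇒> λ le → ∄ (_ , (T⊆ , 1≤d) , le))
      ... | yes (T , nr , le) =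
        let S , nrS , δ≤ , min = argmin (Γ U κ) (touches? V u) touches-resp (Γ-cong U κ) Γ-pos
                                   ℤ.∣ Γ U κ T ∣ nr
                                   (ℤ.≤-reflexive (sym (ℤ.0≤i⇒+∣i∣≡i (ℤ.<⇒≤ (Γ-pos nr)))))
        in tight u∈U deg≤2 N<κu nrS (ℤ.≤-trans δ≤ le) min
        where
        Γ-pos : ∀ {T} → Touches V u T → 0ℤ < Γ U κ T
        Γ-pos (T⊆ , 1≤d) = let v , v∈T , _ = 1≤deg⇒adj 1≤d in pos (⊆-trans T⊆ ∖⊆) (v , v∈T)

      reduce : (∃[ u ] u ∈ V × N * deg V u < κ u + N * 𝟙 (U u)) → Solution V U κ
      reduce (u , u∈V , sparse) with u ∈? U
      ... | no u∉U = recurse (smallerˡ u∈V id⊆ id⊆)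
        (λ v∈U → ∈∖⁺ (U⊆V v∈U) λ v∈u → u∉U (subst (_∈ U) (sym (∈⁅⁆⁻ v∈u)) v∈U))
              lower≤′ (addForest κ≤ u∈V u∉U
                (N*<2N⇒≤1 (subst (N * deg V u <_) eq sparse) (κ≤ u)) pos)
        where
        eq : κ u + N * 𝟙 (U u) ≡ κ u
        eq = trans (cong (λ b → κ u + N * b) (∉⇒𝟙≡0 u∉U))
          (trans (cong (λ z → κ u + z) (ℤ.*-zeroʳ N)) (ℤ.+-identityʳ (κ u)))
      ... | yes u∈U = cases (deg V u ℤ.≤? 1ℤ) (0ℤ ℤ.<? κ u)
        where
        sparse′ : N * deg V u < κ u + N
        sparse′ = subst (N * deg V u <_)
          (trans (cong (λ b → κ u + N * b) (∈⇒𝟙≡1 u∈U))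
            (cong (λ z → κ u + z) (ℤ.*-identityʳ N))) sparse
        cases : Dec (deg V u ≤ 1ℤ) → Dec (0ℤ < κ u) → Solution V U κ
        cases (yes deg≤1) (yes 0<κu) =
          recurse (smallerˡ u∈V id⊆ ∖⊆) (∖-mono U⊆V) κ≤ (addLeaf U⊆V u∈U 0<κu (κ≤ u) deg≤1 pos)
        cases (yes deg≤1) (no κu≤0) = independent u∈U (forcedLeaf U⊆V u∈U (ℤ.≮⇒≥ κu≤0) deg≤1 pos)
        -- The degree is at least 2, so `sparse′` gives `2N < κ u + N`; together with `κ u ≤ 2N` it
        -- also bounds the degree by 2.
        cases (no deg≰1) _ = degreeTwo u∈U (N*<3N⇒≤2 sparse′ (κ≤ u))
          (0<⇒< (0<-resp (lemma N (κ u) (deg V u))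
            (0<+ (<⇒0< sparse′) (0≤* 0≤N (0<⇒0≤-1 (lemma′ (deg V u)) (<⇒0< (ℤ.≰⇒> deg≰1)))))))
          where
          lemma : ∀ N k d → k - N ≡ (k + N - N * d) + N * (d - + 2)
          lemma = solve-∀
          lemma′ : ∀ d → d - + 2 ≡ d - 1ℤ - 1ℤ
          lemma′ = solve-∀

    -- Cycles and components under positive potential

    κ₀ : Fin n → ℤ
    κ₀ _ = + 2 * N - + 2

    deg≥2 : ∀ {T u a b} → a ≢ b → a ∈ T → b ∈ T → a ∈ adj u → b ∈ adj u → + 2 ≤ deg T u
    deg≥2 {T} {u} {a} {b} a≢b a∈T b∈T ua ub =
      subst (+ 2 ≤_) (sym (lin-≐ (𝟙 ∘ adj u) (remove-≐ a∈T)))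
      (ℤ.+-mono-≤ (adj⇒1≤deg u∈⁅u⁆ ua) (adj⇒1≤deg (∈∖⁺ b∈T λ b∈a → a≢b (∈⁅⁆⁻ b∈a)) ub))

    -- Averaging with weights below `2N`. Applied to the vertex set of a cycle, where every degree
    -- is at least 2, it refutes the cycle.
    lowDegree : ∀ {T} → 0ℤ < Φ κ₀ T → ∃[ v ] v ∈ T × deg T v < + 2
    lowDegree {T} 0<Φ = let v , v∈T , lt = Φ-pos⇒∃ 0<Φ in
      v , v∈T , N*-cancel-< (ℤ.<-trans lt (0<⇒< (0<-resp (lemma N) (+<+ (s≤s z≤n)))))
      where
      lemma : ∀ N → N * + 2 - (+ 2 * N - + 2) ≡ + 2
      lemma = solve-∀

    -- The component `C` of `v` enters without paths: it is closed under adjacency in `B` and lies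
    -- inside every such closed set containing `v`.
    module Components (B : Sub) (pos : ∀ {T} → T ⊆ B → Nonempty T → 0ℤ < Φ κ₀ T)
      (C : Sub) (C⊆B : C ⊆ B) (v : Fin n) (v∈C : v ∈ C)
      (connected : ∀ {T} → v ∈ T → (∀ {a b} → a ∈ T → b ∈ B → b ∈ adj a → b ∈ T) → C ⊆ T)
      (closed : ∀ {a b} → a ∈ C → b ∈ B → b ∈ adj a → b ∈ C) where

      -- `T` grows inside `C` along edges. A new vertex adds `2N - 2` and brings at least one edge
      -- costing `2N`, so the bound falls by 2 per vertex. When growth stops, `T` exhausts `C` and
      -- `0 < Φ κ₀ T ≤ 2N - 2|C|`. The number `k` bounds the vertices still missing.
      grow : ∀ k {T} → T ⊆ C → v ∈ T → size C ≤ size T + + k →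
             Φ κ₀ T ≤ + 2 * N - + 2 * size T → size C < N
      grow k {T} T⊆C v∈T C≤ Φ≤ with nonempty? (near T ∩ (C ∖ T))
      ... | no ∅ = 0<⇒< (half (0<-resp (lemma N (size C) (size T) (Φ κ₀ T))
        (0<+ (pos (λ a∈ → C⊆B (T⊆C a∈)) (v , v∈T))
          (0≤+ (≤⇒0≤ Φ≤) (0≤* {+ 2} (+≤+ z≤n) (≤⇒0≤ (size-⊆ C⊆T)))))))
        where
        C⊆T : C ⊆ T
        C⊆T = connected v∈T stays
          where
          stays : ∀ {a b} → a ∈ T → b ∈ B → b ∈ adj a → b ∈ T
          stays {a} {b} a∈T b∈B ab with b ∈? T
          ... | yes b∈T = b∈T
          ... | no  b∉T = contradiction
            (b , ∈∩⁺ (∈near⁺ (adj⇒1≤deg a∈T (adj-swap ab))) (∈∖⁺ (closed (T⊆C a∈T) b∈B ab) b∉T)) ∅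
        half : ∀ {z} → 0ℤ < + 2 * z → 0ℤ < z
        half {z} = ℤ.*-cancelˡ-<-nonNeg {0ℤ} {z} (+ 2)
        lemma : ∀ N c s f → + 2 * (N - c) ≡ f + ((+ 2 * N - + 2 * s - f) + + 2 * (s - c))
        lemma = solve-∀
      ... | yes (w , w∈) = step k C≤
        where
        w∈near = proj₁ (∈∩⁻ w∈)
        w∈C = proj₁ (∈∖⁻ (proj₂ (∈∩⁻ w∈)))
        w∉T = proj₂ (∈∖⁻ (proj₂ (∈∩⁻ w∈)))
        T′ = ⁅ w ⁆ ∪ T
        T′⊆C : T′ ⊆ C
        T′⊆C a∈ = [ ∈⇒⁅⁆⊆ w∈C , T⊆C ]′ (∈∪⁻ a∈)
        size′ : size T′ ≡ 1ℤ + size T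
        size′ = trans (lin-≐ (λ _ → 1ℤ) (insert-≐ w∉T)) (cong (_+ size T) (lin-⁅⁆ (λ _ → 1ℤ) w))
        Φ′ : Φ κ₀ T′ ≤ + 2 * N - + 2 * size T′
        Φ′ = 0≤⇒≤ (0≤-resp (trans
          (cong₂ (λ s f → + 2 * N - + 2 * s - f) size′ (Φ-insert κ₀ (insert-≐ w∉T)))
                (lemma N (size T) (Φ κ₀ T) (deg T w)))
              (0≤+ (≤⇒0≤ Φ≤) (0≤* 0≤2N (≤⇒0≤ (∈near⁻ w∈near)))))
          where
          lemma : ∀ N s f d → + 2 * N - + 2 * (1ℤ + s) - ((+ 2 * N - + 2) + f - + 2 * (N * d)) ≡
                  (+ 2 * N - + 2 * s - f) + + 2 * N * (d - 1ℤ)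
          lemma = solve-∀
        step : ∀ k → size C ≤ size T + + k → size C < N
        step zero C≤ = contradiction
          (ℤ.≤-trans (ℤ.≤-reflexive (sym size′)) (ℤ.≤-trans (size-⊆ T′⊆C) C≤))
          (ℤ.<⇒≱ (0<⇒< (0<-resp (lemma (size T)) (+<+ (s≤s z≤n)))))
          where
          lemma : ∀ s → 1ℤ + s - (s + 0ℤ) ≡ 1ℤ
          lemma = solve-∀
        step (suc k) C≤ = grow k T′⊆C (∈∪⁺ʳ v∈T)
          (ℤ.≤-trans C≤ (ℤ.≤-reflexive
            (trans (lemma (size T) (+ k)) (cong (_+ + k) (sym size′))))) Φ′
          where
          lemma : ∀ s k → s + (1ℤ + k) ≡ 1ℤ + s + k
          lemma = solve-∀

  -- The bound on mad as an inequality between integers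

  ι : ℤ → ℚ
  ι i = i ℚ./ 1

  -- Identities between fractions are checked on unnormalised rationals, where no common divisor has
  -- to be cancelled.
  toℚᵘ-/ : ∀ i k → toℚᵘ (i ℚ./ suc k) ℚᵘ.≃ mkℚᵘ i k
  toℚᵘ-/ i k = ℚ.toℚᵘ-fromℚᵘ (mkℚᵘ i k)

  ι-homo-+ : ∀ i j → ι (i ℤ.+ j) ≡ ι i ℚ.+ ι j
  ι-homo-+ i j = ℚ.toℚᵘ-injective (begin-equality
    toℚᵘ (ι (i ℤ.+ j))            ≃⟨ toℚᵘ-/ (i ℤ.+ j) 0 ⟩
    mkℚᵘ (i ℤ.+ j) 0              ≃⟨ *≡* (lemma i j) ⟩
    mkℚᵘ i 0 ℚᵘ.+ mkℚᵘ j 0        ≃⟨ ℚᵘ.+-cong (toℚᵘ-/ i 0) (toℚᵘ-/ j 0) ⟨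
    toℚᵘ (ι i) ℚᵘ.+ toℚᵘ (ι j)    ≃⟨ ℚ.toℚᵘ-homo-+ (ι i) (ι j) ⟨
    toℚᵘ (ι i ℚ.+ ι j)            ∎)
    where
    open ℚᵘ.≤-Reasoning
    lemma : ∀ i j → (i ℤ.+ j) ℤ.* + 1 ≡ (i ℤ.* + 1 ℤ.+ j ℤ.* + 1) ℤ.* + 1
    lemma = solve-∀

  /-*-ι : ∀ i k → (i ℚ./ suc k) ℚ.* ι (+ suc k) ≡ ι i
  /-*-ι i k = ℚ.toℚᵘ-injective (begin-equality
    toℚᵘ ((i ℚ./ suc k) ℚ.* ι (+ suc k))          ≃⟨ ℚ.toℚᵘ-homo-* (i ℚ./ suc k) (ι (+ suc k)) ⟩
    toℚᵘ (i ℚ./ suc k) ℚᵘ.* toℚᵘ (ι (+ suc k))    ≃⟨ ℚᵘ.*-cong (toℚᵘ-/ i k) (toℚᵘ-/ (+ suc k) 0) ⟩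
    mkℚᵘ i k ℚᵘ.* mkℚᵘ (+ suc k) 0                 ≃⟨ *≡* eq ⟩
    mkℚᵘ i 0                                       ≃⟨ toℚᵘ-/ i 0 ⟨
    toℚᵘ (ι i)                                     ∎)
    where
    open ℚᵘ.≤-Reasoning
    eq : i ℤ.* + suc k ℤ.* + 1 ≡ i ℤ.* + (suc k ℕ.* 1)
    eq = trans (ℤ.*-identityʳ (i ℤ.* + suc k))
      (cong (λ m → i ℤ.* + m) (sym (ℕ.*-identityʳ (suc k))))

  ι-homo-* : ∀ i j → ι (i ℤ.* j) ≡ ι i ℚ.* ι j
  ι-homo-* i j = ℚ.toℚᵘ-injective (begin-equality
    toℚᵘ (ι (i ℤ.* j))            ≃⟨ toℚᵘ-/ (i ℤ.* j) 0 ⟩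
    mkℚᵘ i 0 ℚᵘ.* mkℚᵘ j 0        ≃⟨ ℚᵘ.*-cong (toℚᵘ-/ i 0) (toℚᵘ-/ j 0) ⟨
    toℚᵘ (ι i) ℚᵘ.* toℚᵘ (ι j)    ≃⟨ ℚ.toℚᵘ-homo-* (ι i) (ι j) ⟨
    toℚᵘ (ι i ℚ.* ι j)            ∎)
    where open ℚᵘ.≤-Reasoning

  ι-cancel-< : ∀ {i j} → ι i ℚ.< ι j → i ℤ.< j
  ι-cancel-< {i} {j} ιi<ιj = subst₂ ℤ._<_ (ℤ.*-identityʳ i) (ℤ.*-identityʳ j)
    (ℚᵘ.drop-*<* (ℚᵘ.<-respʳ-≃ (toℚᵘ-/ j 0) (ℚᵘ.<-respˡ-≃ (toℚᵘ-/ i 0) (ℚ.toℚᵘ-mono-< ιi<ιj))))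

  ι-mono-< : ∀ {i j} → i ℤ.< j → ι i ℚ.< ι j
  ι-mono-< {i} {j} i<j = ℚ.toℚᵘ-cancel-<
    (ℚᵘ.<-respʳ-≃ (ℚᵘ.≃-sym (toℚᵘ-/ j 0)) (ℚᵘ.<-respˡ-≃ (ℚᵘ.≃-sym (toℚᵘ-/ i 0))
      (*<* (subst₂ ℤ._<_ (sym (ℤ.*-identityʳ i)) (sym (ℤ.*-identityʳ j)) i<j))))

  *-mono-pos : ∀ {r p q} → 0ℚ ℚ.< r → p ℚ.< q → p ℚ.* r ℚ.< q ℚ.* r
  *-mono-pos {r} 0<r = ℚ.*-monoˡ-<-pos r {{ℚ.positive 0<r}}

  -- From `p < d` and `2 < (p + 2) l` it follows that `l` exceeds `2 / (d + 2)`. The average `a / b`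
  -- is thus below `3 - 2 / (d + 2)`, and multiplying by `b (d + 2)` leaves an inequality between
  -- integers.
  clearDenominators : ∀ a b .{{_ : ℕ.NonZero b}} d {l p} → 0ℚ ℚ.< l → p ℚ.< ι (+ d) →
                      ι (+ 2) ℚ.< (p ℚ.+ ι (+ 2)) ℚ.* l →
                      (a ℚ./ b) ℚ.< ι (+ 3) ℚ.- l →
                      a ℤ.* + (d ℕ.+ 2) ℤ.+ + 2 ℤ.* + b ℤ.< + 3 ℤ.* (+ (d ℕ.+ 2) ℤ.* + b)
  clearDenominators a (suc k) d {l} {p} 0<l p<d 2<pl avg<3-l = ι-cancel-< (begin-strict
    ι (a ℤ.* D ℤ.+ + 2 ℤ.* K)
      ≡⟨ trans (ι-homo-+ (a ℤ.* D) (+ 2 ℤ.* K)) (cong₂ ℚ._+_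
           (trans (ι-homo-* a D) (cong (ℚ._* ι D) (sym (/-*-ι a k)))) (ι-homo-* (+ 2) K)) ⟩
    avg ℚ.* ι K ℚ.* ι D ℚ.+ ι (+ 2) ℚ.* ι K
      <⟨ ℚ.+-monoʳ-< (avg ℚ.* ι K ℚ.* ι D)
        (*-mono-pos 0<K (ℚ.<-trans 2<pl (*-mono-pos 0<l p+2<D))) ⟩
    avg ℚ.* ι K ℚ.* ι D ℚ.+ ι D ℚ.* l ℚ.* ι K
      ≡⟨ regroup avg (ι K) (ι D) l ⟩
    (avg ℚ.+ l) ℚ.* (ι D ℚ.* ι K)
      <⟨ *-mono-pos 0<DK (subst (avg ℚ.+ l ℚ.<_) (cancel (ι (+ 3)) l) (ℚ.+-monoˡ-< l avg<3-l)) ⟩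
    ι (+ 3) ℚ.* (ι D ℚ.* ι K)
      ≡⟨ trans (ι-homo-* (+ 3) (D ℤ.* K)) (cong (ι (+ 3) ℚ.*_) (ι-homo-* D K)) ⟨
    ι (+ 3 ℤ.* (D ℤ.* K)) ∎)
    where
    open ℚ.≤-Reasoning
    D = + (d ℕ.+ 2)
    K = + suc k
    avg = a ℚ./ suc k
    0<K : 0ℚ ℚ.< ι K
    0<K = ι-mono-< {+ 0} {K} (ℤ.+<+ (ℕ.s≤s ℕ.z≤n))
    0<DK : 0ℚ ℚ.< ι D ℚ.* ι K
    0<DK = subst (ℚ._< ι D ℚ.* ι K) (ℚ.*-zeroˡ (ι K))
      (*-mono-pos 0<K (ι-mono-< {+ 0} {D} (ℤ.+<+ (ℕ.≤-trans (ℕ.s≤s ℕ.z≤n) (ℕ.m≤n+m 2 d)))))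
    p+2<D : p ℚ.+ ι (+ 2) ℚ.< ι D
    p+2<D = subst (p ℚ.+ ι (+ 2) ℚ.<_) (sym (ι-homo-+ (+ d) (+ 2))) (ℚ.+-monoˡ-< (ι (+ 2)) p<d)
    open ℚ-Solver using (solve; _:+_; _:*_; _:-_; _:=_)
    regroup : ∀ a k d l → a ℚ.* k ℚ.* d ℚ.+ d ℚ.* l ℚ.* k ≡ (a ℚ.+ l) ℚ.* (d ℚ.* k)
    regroup = solve 4 (λ a k d l → a :* k :* d :+ d :* l :* k := (a :+ l) :* (d :* k)) refl
    cancel : ∀ t l → t ℚ.- l ℚ.+ l ≡ t
    cancel = solve 2 (λ t l → t :- l :+ l := t) refl

  -- From lists and subsets to integer sums

  𝟙-yes : ∀ {P : Set} (P? : Dec P) → P → 𝟙 (does P?) ≡ 1ℤ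
  𝟙-yes P? p = cong 𝟙 (dec-true P? p)

  𝟙-no : ∀ {P : Set} (P? : Dec P) → ¬ P → 𝟙 (does P?) ≡ 0ℤ
  𝟙-no P? ¬p = cong 𝟙 (dec-false P? ¬p)

  listSum : ∀ {A : Set} → (A → ℤ) → List A → ℤ
  listSum f []       = 0ℤ
  listSum f (x ∷ xs) = f x + listSum f xs

  length-filter : ∀ {A : Set} {P : A → Set} (P? : ∀ x → Dec (P x)) xs →
                  + length (filter P? xs) ≡ listSum (λ x → 𝟙 (does (P? x))) xs
  length-filter P? []       = refl
  length-filter P? (x ∷ xs) with does (P? x)
  ... | true  = cong (λ m → 1ℤ + m) (length-filter P? xs)
  ... | false = trans (length-filter P? xs)
    (sym (ℤ.+-identityˡ (listSum (λ x → 𝟙 (does (P? x))) xs)))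

  listSum-++ : ∀ {A : Set} (f : A → ℤ) xs ys → listSum f (xs ++ ys) ≡ listSum f xs + listSum f ys
  listSum-++ f []       ys = sym (ℤ.+-identityˡ (listSum f ys))
  listSum-++ f (x ∷ xs) ys = trans (cong (λ s → f x + s) (listSum-++ f xs ys))
    (sym (ℤ.+-assoc (f x) (listSum f xs) (listSum f ys)))

  listSum-map : ∀ {A B : Set} (f : B → ℤ) (g : A → B) xs → listSum f (map g xs) ≡ listSum (f ∘ g) xs
  listSum-map f g []       = refl
  listSum-map f g (x ∷ xs) = cong (λ s → f (g x) + s) (listSum-map f g xs)

  listSum-cartesianProduct : ∀ {A B : Set} (f : A × B → ℤ) xs ys →
    listSum f (cartesianProduct xs ys) ≡ listSum (λ x → listSum (λ y → f (x , y)) ys) xs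
  listSum-cartesianProduct f []       ys = refl
  listSum-cartesianProduct f (x ∷ xs) ys =
    trans (listSum-++ f (map (x ,_) ys) (cartesianProduct xs ys))
    (cong₂ _+_ (listSum-map f (x ,_) ys) (listSum-cartesianProduct f xs ys))

  listSum-tabulate : ∀ {A : Set} {n} (f : A → ℤ) (g : Fin n → A) →
                     listSum f (List.tabulate g) ≡ sum (f ∘ g)
  listSum-tabulate {n = zero}  f g = refl
  listSum-tabulate {n = suc n} f g = cong (λ s → f (g zero) + s) (listSum-tabulate f (g ∘ suc))

  listSum-allFin² : ∀ {n} (f : Fin n × Fin n → ℤ) →
    listSum f (cartesianProduct (allFin n) (allFin n)) ≡ sum λ u → sum λ v → f (u , v)
  listSum-allFin² {n} f = trans (listSum-cartesianProduct f (allFin n) (allFin n))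
    (trans (listSum-tabulate (λ u → listSum (λ v → f (u , v)) (allFin n)) id)
           (sum-cong-≗ λ u → listSum-tabulate (λ v → f (u , v)) id))

  module _ {n : ℕ} where
    open Sets n

    ∈ˢ⁺ : ∀ {v p} → v ∈ lookup p → v Subset.∈ p
    ∈ˢ⁺ {v} {p} (mem eq) = lookup⇒[]= v p eq

    ∈ˢ⁻ : ∀ {v p} → v Subset.∈ p → v ∈ lookup p
    ∈ˢ⁻ v∈p = mem ([]=⇒lookup v∈p)

    ∈tabulate⁺ : ∀ {v T} → v ∈ T → v Subset.∈ tabulate T
    ∈tabulate⁺ {v} {T} (mem eq) = ∈ˢ⁺ (mem (trans (lookup∘tabulate T v) eq))

    ∈tabulate⁻ : ∀ {v T} → v Subset.∈ tabulate T → v ∈ T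
    ∈tabulate⁻ {v} {T} v∈ = mem (trans (sym (lookup∘tabulate T v)) (_∈_.holds (∈ˢ⁻ v∈)))

  opaque
    unfolding Sets.lin

    size-lookup : ∀ {n} (p : Subset.Subset n) → Sets.size n (lookup p) ≡ + Subset.∣ p ∣
    size-lookup []          = refl
    size-lookup (true ∷ p)  = cong (λ m → 1ℤ + m) (size-lookup p)
    size-lookup (false ∷ p) = trans (ℤ.+-identityˡ (Sets.size _ (lookup p))) (size-lookup p)

    lin-lin : ∀ {n} (b : Fin n → Fin n → ℤ) S T →
              Sets.lin n (λ u → Sets.lin n (b u) T) S ≡
              sum λ u → sum λ v → 𝟙 (S u) * (𝟙 (T v) * b u v)
    lin-lin b S T = sum-cong-≗ λ u → *-distribˡ-sum (𝟙 (S u)) (λ v → 𝟙 (T v) * b u v)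

  -- Application to a graph

  module OfGraph {n : ℕ} (G : Graph n) (d : ℕ) where
    open Sets n
    open Graph G using (_~_; _~?_; ~-sym; ~-irrefl)

    N : ℤ
    N = + (d ℕ.+ 2)

    0<N : 0ℤ < N
    0<N = +<+ (ℕ.≤-trans (s≤s z≤n) (ℕ.m≤n+m 2 d))

    V : Sub
    V = lookup (Graph.V G)

    adj : Fin n → Sub
    adj u v = does (u ~? v)

    adj⁺ : ∀ {u v} → u ~ v → v ∈ adj u
    adj⁺ {u} {v} e = mem (dec-true (u ~? v) e)

    adj⁻ : ∀ {u v} → v ∈ adj u → u ~ v
    adj⁻ {u} {v} (mem eq) = does⇒ (u ~? v) eq

    adj-sym : ∀ u v → adj u v ≡ adj v u
    adj-sym u v with v ~? u
    ... | yes e = dec-true (u ~? v) (~-sym e)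
    ... | no ¬e = dec-false (u ~? v) (¬e ∘ ~-sym)

    adj-irrefl : ∀ u → adj u u ≡ false
    adj-irrefl u = dec-false (u ~? u) ~-irrefl

    open Potential adj adj-sym adj-irrefl N 0<N

    -- The list of edges holds only pairs with `u < v`. The indicator of an ordered adjacent pair is
    -- therefore `e u v + e v u`, with exactly one term equal to 1, and exchanging the sums shows
    -- that both halves agree.
    edges≡2E : ∀ T → edges T T ≡ + 2 * + length (Graph.E (G [ tabulate T ]))
    edges≡2E T = begin
      edges T T
        ≡⟨ lin-lin (λ u v → 𝟙 (adj u v)) T T ⟩
      sum (λ u → sum λ v → 𝟙 (T u) * (𝟙 (T v) * 𝟙 (adj u v)))
        ≡⟨ sum-cong-≗ (λ u → trans (sum-cong-≗ λ v → once u v) (∑-distrib-+ (e u) (λ v → e v u))) ⟩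
      sum (λ u → sum (e u) + sum λ v → e v u)
        ≡⟨ ∑-distrib-+ (λ u → sum (e u)) (λ u → sum λ v → e v u) ⟩
      sum (λ u → sum (e u)) + sum (λ u → sum λ v → e v u)
        ≡⟨ cong (λ s → sum (λ u → sum (e u)) + s) (∑-comm λ u v → e v u) ⟩
      sum (λ u → sum (e u)) + sum (λ u → sum (e u))
        ≡⟨ double (sum λ u → sum (e u)) ⟩
      + 2 * sum (λ u → sum (e u))
        ≡⟨ cong (λ s → + 2 * s) (trans
          (length-filter (Graph.edge? H) (cartesianProduct (allFin n) (allFin n)))
             (listSum-allFin² λ (u , v) → e u v)) ⟨
      + 2 * + length (Graph.E H) ∎
      where
      open ≡-Reasoning
      H = G [ tabulate T ]
      e : Fin n → Fin n → ℤ
      e u v = 𝟙 (does (Graph.edge? H (u , v)))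
      double : ∀ s → s + s ≡ + 2 * s
      double = solve-∀
      once : ∀ u v → 𝟙 (T u) * (𝟙 (T v) * 𝟙 (adj u v)) ≡ e u v + e v u
      once u v with u ∈? T | v ∈? T | v ∈? adj u
      ... | no u∉T | _ | _ = trans (cong (_* (𝟙 (T v) * 𝟙 (adj u v))) (∉⇒𝟙≡0 u∉T))
        (sym (cong₂ _+_ (𝟙-no (Graph.edge? H (u , v)) λ (_ , _ , u∈ , _) → u∉T (∈tabulate⁻ u∈))
                        (𝟙-no (Graph.edge? H (v , u)) λ (_ , _ , _ , u∈) → u∉T (∈tabulate⁻ u∈))))
      ... | yes _ | no v∉T | _ = trans (cong (λ t → 𝟙 (T u) * (t * 𝟙 (adj u v))) (∉⇒𝟙≡0 v∉T))
        (trans (ℤ.*-zeroʳ (𝟙 (T u)))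
        (sym (cong₂ _+_ (𝟙-no (Graph.edge? H (u , v)) λ (_ , _ , _ , v∈) → v∉T (∈tabulate⁻ v∈))
                        (𝟙-no (Graph.edge? H (v , u)) λ (_ , _ , v∈ , _) → v∉T (∈tabulate⁻ v∈)))))
      ... | yes _ | yes _ | no ¬uv = trans (cong (λ t → 𝟙 (T u) * (𝟙 (T v) * t)) (∉⇒𝟙≡0 ¬uv))
        (trans (trans (cong (λ t → 𝟙 (T u) * t) (ℤ.*-zeroʳ (𝟙 (T v)))) (ℤ.*-zeroʳ (𝟙 (T u))))
        (sym (cong₂ _+_ (𝟙-no (Graph.edge? H (u , v)) λ (_ , uv , _) → ¬uv (adj⁺ uv))
                        (𝟙-no (Graph.edge? H (v , u)) λ (_ , vu , _) → ¬uv (adj⁺ (~-sym vu))))))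
      ... | yes u∈T | yes v∈T | yes uv = trans
        (cong₂ _*_ (∈⇒𝟙≡1 u∈T) (cong₂ _*_ (∈⇒𝟙≡1 v∈T) (∈⇒𝟙≡1 uv)))
        (sym (order (Fin.<-cmp u v)))
        where
        uvᴴ : Graph._~_ H u v
        uvᴴ = adj⁻ uv , ∈tabulate⁺ u∈T , ∈tabulate⁺ v∈T
        order : _ → e u v + e v u ≡ 1ℤ
        order (tri< u<v _ v≮u) = cong₂ _+_ (𝟙-yes (Graph.edge? H (u , v)) (u<v , uvᴴ))
          (𝟙-no (Graph.edge? H (v , u)) λ (v<u , _) → v≮u v<u)
        order (tri≈ _ refl _)  = contradiction (adj⁻ uv) ~-irrefl
        order (tri> u≮v _ v<u) = cong₂ _+_ (𝟙-no (Graph.edge? H (u , v)) λ (u<v , _) → u≮v u<v)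
          (𝟙-yes (Graph.edge? H (v , u)) (v<u , Graph.~-sym H uvᴴ))

    size-V : ∀ {T} → T ⊆ V → size T ≡ + Subset.∣ Graph.V (G [ tabulate T ]) ∣
    size-V {T} T⊆V = trans (lin-cong (λ _ → 1ℤ) ≗) (size-lookup (Graph.V (G [ tabulate T ])))
      where
      ≗ : ∀ v → T v ≡ lookup (Graph.V (G [ tabulate T ])) v
      ≗ v with v ∈? T | v ∈? lookup (Graph.V (G [ tabulate T ]))
      ... | yes (mem v∈T) | yes (mem v∈) = trans v∈T (sym v∈)
      ... | no  v∉T | no v∉ = trans (∉⇒≡false v∉T) (sym (∉⇒≡false v∉))
      ... | yes v∈T | no v∉ = contradiction
        (∈ˢ⁻ {p = Graph.V (G [ tabulate T ])} (Subset.x∈p∩q⁺ (∈ˢ⁺ (T⊆V v∈T) , ∈tabulate⁺ v∈T))) v∉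
      ... | no v∉T | yes v∈ = contradiction
        (∈tabulate⁻ (proj₂ (Subset.x∈p∩q⁻ (Graph.V G) (tabulate T) (∈ˢ⁺ v∈)))) v∉T

    lin-const : ∀ k T → lin (λ _ → k) T ≡ k * size T
    lin-const k T = trans (lin-≡ λ _ → lemma k) (trans (lin-+* (λ _ → 0ℤ) k (λ _ → 1ℤ) T)
      (trans (cong (_+ k * size T) (lin-0 T)) (ℤ.+-identityˡ (k * size T))))
      where
      lemma : ∀ k → k ≡ 0ℤ + k * 1ℤ
      lemma = solve-∀

    -- At the start every vertex is undecided. For the induced subgraph on `T`, with `s` vertices
    -- and `m` edges, the potential is `(3N - 2) s - 2 m N`, which is positive because the average
    -- degree is below `3 - 2 / N`.
    initial : ∀ {l p} → 0ℚ ℚ.< l → p ℚ.< ι (+ d) →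
              ι (+ 2) ℚ.< (p ℚ.+ ι (+ 2)) ℚ.* l → mad G ℚ.< ι (+ 3) ℚ.- l →
              Positive V V κ₀
    initial {l} {p} 0<l p<d 2<pl mad<3-l {T} T⊆V (v , v∈T) = 0<-resp eq (<⇒0< bound)
      where
      H = G [ tabulate T ]
      ne : Subset.Nonempty (Graph.V H)
      ne = v , Subset.x∈p∩q⁺ (∈ˢ⁺ (T⊆V v∈T) , ∈tabulate⁺ v∈T)
      m = length (Graph.E H)
      s = Subset.∣ Graph.V H ∣
      bound : + (2 ℕ.* m) * N + + 2 * + s < + 3 * (N * + s)
      bound = clearDenominators (+ (2 ℕ.* m)) s {{nonempty⇒∣∣≢0 ne}} d 0<l p<d 2<pl
        (ℚ.≤-<-trans (mad-upper G H (Subset.p∩q⊆p (Graph.V G) (tabulate T) , proj₁) ne) mad<3-l)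
      eq : Γ V κ₀ T ≡ + 3 * (N * + s) - (+ (2 ℕ.* m) * N + + 2 * + s)
      eq = trans (cong₂ (λ a b → lin κ₀ T - N * a + N * b) (edges≡2E T) count≡)
        (trans (cong (λ a → a - N * (+ 2 * + m) + N * size T) (lin-const (+ 2 * N - + 2) T))
        (trans (cong (λ b → (+ 2 * N - + 2) * b - N * (+ 2 * + m) + N * b) (size-V T⊆V))
        (trans (lemma N (+ s) (+ 2 * + m))
          (cong (λ a → + 3 * (N * + s) - (a * N + + 2 * + s)) (sym (ℤ.pos-* 2 m))))))
        where
        count≡ : count V T ≡ size T
        count≡ = lin-≡ λ v∈T → ∈⇒𝟙≡1 (T⊆V v∈T)
        lemma : ∀ N s e → (+ 2 * N - + 2) * s - N * e + N * s ≡ + 3 * (N * s) - (e * N + + 2 * s)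
        lemma = solve-∀

    module Partition (sol : Solution V V κ₀) where
      open Solution sol

      F : Sub
      F = V ∖ I

      A B : Subset.Subset n
      A = tabulate I
      B = tabulate F

      B⊆F : ∀ {v} → v Subset.∈ Graph.V (G [ B ]) → v ∈ F
      B⊆F v∈ = ∈tabulate⁻ (proj₂ (Subset.x∈p∩q⁻ (Graph.V G) B v∈))

      isPartition : IsPartition (Graph.V G) A B
      isPartition = Subset.⊆-antisym A∪B⊆V V⊆A∪B , λ (v , v∈) →
        let v∈A , v∈B = Subset.x∈p∩q⁻ A B v∈ in proj₂ (∈∖⁻ (∈tabulate⁻ v∈B)) (∈tabulate⁻ v∈A)
        where
        A∪B⊆V : A Subset.∪ B Subset.⊆ Graph.V G
        A∪B⊆V v∈ = [ (λ v∈A → ∈ˢ⁺ (I⊆U (∈tabulate⁻ v∈A))) , (λ v∈B → ∈ˢ⁺ (∖⊆ (∈tabulate⁻ v∈B))) ]′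
          (Subset.x∈p∪q⁻ A B v∈)
        V⊆A∪B : Graph.V G Subset.⊆ A Subset.∪ B
        V⊆A∪B {v} v∈ with v ∈? I
        ... | yes v∈I = Subset.x∈p∪q⁺ (inj₁ (∈tabulate⁺ v∈I))
        ... | no  v∉I = Subset.x∈p∪q⁺ (inj₂ (∈tabulate⁺ (∈∖⁺ (∈ˢ⁻ v∈) v∉I)))

      independent-A : Independent G A
      independent-A u∈A v∈A e = indep (∈tabulate⁻ u∈A) (∈tabulate⁻ v∈A) (adj⁺ e)

      forest : Forest (G [ B ])
      forest cyc =
        let v , v∈T , deg<2 = lowDegree (pos T⊆F (c zero , image zero)) in absurd v∈T deg<2
        where
        open Cycle cyc
        T : Sub
        T v = does (Fin.any? λ i → c i ≟ v)
        image : ∀ i → c i ∈ T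
        image i = mem (dec-true (Fin.any? λ j → c j ≟ c i) (i , refl))
        neighbours : ∀ i → ∃[ p ] ∃[ q ] p ≢ q ×
          Graph._~_ (G [ B ]) (c i) (c p) × Graph._~_ (G [ B ]) (c i) (c q)
        neighbours = cyclic-neighbours (Graph._~_ (G [ B ])) (Graph.~-sym (G [ B ])) c step closed
        c∈F : ∀ i → c i ∈ F
        c∈F i = let _ , _ , _ , (_ , ci∈ , _) , _ = neighbours i in ∈tabulate⁻ ci∈
        T⊆F : T ⊆ F
        T⊆F {v} (mem v∈T) =
          let i , ci≡v = does⇒ (Fin.any? λ i → c i ≟ v) v∈T in subst (_∈ F) ci≡v (c∈F i)
        absurd : ∀ {v} → v ∈ T → ¬ deg T v < + 2
        absurd {v} (mem v∈T) deg<2 with does⇒ (Fin.any? λ i → c i ≟ v) v∈T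
        ... | i , refl =
          let p , q , p≢q , (cp , _) , (cq , _) = neighbours i
          in ℤ.<⇒≱ deg<2 (deg≥2 (p≢q ∘ c-inj) (image p) (image q) (adj⁺ cp) (adj⁺ cq))

      component : ∀ C → IsComponent (G [ B ]) C → Subset.∣ C ∣ ℕ.≤ d ℕ.+ 1
      component C (v , v∈B , reach) =
        -- `grow` yields a strict bound by `N`, which is `d + 2`, and hence at most `d + 1`
        -- vertices.
        ℕ.≤-pred (subst (Subset.∣ C ∣ ℕ.<_) (ℕ.+-suc d 1) (ℤ.drop‿+<+ (subst (_< N) (size-lookup C)
          (grow Subset.∣ C ∣ (∈⇒⁅⁆⊆ v∈C) u∈⁅u⁆ C≤ Φ≤))))
        where
        C′ = lookup C
        to : ∀ {u} → u ∈ C′ → Star (Graph._~_ (G [ B ])) v u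
        to {u} u∈ = Equivalence.to (reach u) (∈ˢ⁺ u∈)
        from : ∀ {u} → Star (Graph._~_ (G [ B ])) v u → u ∈ C′
        from {u} path = ∈ˢ⁻ (Equivalence.from (reach u) path)
        v∈C : v ∈ C′
        v∈C = from ε
        end∈F : ∀ {x y} → x ∈ F → Star (Graph._~_ (G [ B ])) x y → y ∈ F
        end∈F x∈ ε = x∈
        end∈F x∈ ((_ , _ , z∈) ◅ path) = end∈F (∈tabulate⁻ z∈) path
        C⊆F : C′ ⊆ F
        C⊆F u∈ = end∈F (B⊆F v∈B) (to u∈)
        edge : ∀ {a b} → a ∈ F → b ∈ F → b ∈ adj a → Graph._~_ (G [ B ]) a b
        edge a∈ b∈ ab = adj⁻ ab , ∈tabulate⁺ a∈ , ∈tabulate⁺ b∈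
        connected : ∀ {T} → v ∈ T → (∀ {a b} → a ∈ T → b ∈ F → b ∈ adj a → b ∈ T) → C′ ⊆ T
        connected {T} v∈T stays u∈ = walk v∈T (to u∈)
          where
          walk : ∀ {x y} → x ∈ T → Star (Graph._~_ (G [ B ])) x y → y ∈ T
          walk x∈ ε = x∈
          walk x∈ ((e , _ , z∈) ◅ path) = walk (stays x∈ (∈tabulate⁻ z∈) (adj⁺ e)) path
        closed : ∀ {a b} → a ∈ C′ → b ∈ F → b ∈ adj a → b ∈ C′
        closed a∈ b∈ ab = from (to a∈ ◅◅ (edge (C⊆F a∈) b∈ ab ◅ ε))
        open Components F pos C′ C⊆F v v∈C connected closed
        size-v : size ⁅ v ⁆ ≡ 1ℤ
        size-v = lin-⁅⁆ (λ _ → 1ℤ) v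
        C≤ : size C′ ≤ size ⁅ v ⁆ + + Subset.∣ C ∣
        C≤ = subst₂ (λ a b → a ≤ b + + Subset.∣ C ∣) (sym (size-lookup C)) (sym size-v)
          (ℤ.i≤j+i (+ Subset.∣ C ∣) 1ℤ)
        Φ≤ : Φ κ₀ ⁅ v ⁆ ≤ + 2 * N - + 2 * size ⁅ v ⁆
        Φ≤ = ℤ.≤-reflexive (trans (Φ-⁅⁆ κ₀ v) (cong (λ z → + 2 * N - + 2 * z) (sym size-v)))

  partition : ∀ {n} (G : Graph n) d {l p} → 0ℚ ℚ.< l → p ℚ.< ι (+ d) →
    ι (+ 2) ℚ.< (p ℚ.+ ι (+ 2)) ℚ.* l →
    mad G ℚ.< ι (+ 3) ℚ.- l →
    ∃[ A ] ∃[ B ] (IsPartition (Graph.V G) A B × Independent G A × Forest (G [ B ]) ×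
      (∀ C → IsComponent (G [ B ]) C → Subset.∣ C ∣ ℕ.≤ d ℕ.+ 1))
  partition {n} G d 0<l p<d 2<pl mad<3-l = A , B , isPartition , independent-A , forest , component
    where
    open OfGraph G d
    open Sets n
    open Potential adj adj-sym adj-irrefl N 0<N
    κ≤2N : ∀ v → κ₀ v ≤ + 2 * N
    κ≤2N _ = 0≤⇒≤ (0≤-resp (lemma N) (+≤+ z≤n))
      where
      lemma : ∀ N → + 2 * N - (+ 2 * N - + 2) ≡ + 2
      lemma = solve-∀
    open Partition (solution ℤ.∣ measure V V ∣
      (ℤ.≤-reflexive (sym (ℤ.0≤i⇒+∣i∣≡i
        (0≤+ (lin-nonneg λ _ → +≤+ z≤n) (lin-nonneg λ _ → +≤+ z≤n)))))
      (λ v∈ → v∈) κ≤2N (initial 0<l p<d 2<pl mad<3-l))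

open import Defs
open import Data.Fin.Subset using (Subset; ∣_∣)
open import Data.Integer.Base using (pos)
open import Data.Nat using (ℕ; _>_; _≤_; _+_)
open import Data.Product using (_×_; ∃-syntax; _,_)
open import Data.Rational.Properties using (<-trans)
open Extension using (partition)

theorem9 : (M : ℝ) (M<3 : M <ᴿ fromℕᴿ 3) (d : ℕ) → d > 0 →
    ∀ {n} (G : Graph n) → fromℚ (mad G) <ᴿ M →
    (fromℕℚ 2 ℚ÷ᴿ (fromℕℚ 3 ℚ-ᴿ M)) (x<a⇒0<a-x (fromℕℚ 3) M M<3) ᴿ-ℚ fromℕℚ 2 <ᴿ fromℕᴿ d →
    ∃[ A ] ∃[ B ] (IsPartition (Graph.V G) A B × Independent G A × Forest (G [ B ]) ×
    (∀ (C : Subset n) → IsComponent (G [ B ]) C → ∣ C ∣ ≤ d + 1))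
-- The cuts supply rationals: `q` between `mad G` and `M`, `p` between `2 / (3 - M) - 2` and `d`,
-- and `l` with `0 < l < 3 - M` and `2 < (p + 2) l`. Then `mad G < q < 3 - l`, and the rest is
-- rational arithmetic.
theorem9 M M<3 d _ G (q , mad<q , q<M) (p , (l , 0<l , M<3-l , 2<pl) , p<d) =
  partition G d 0<l p<d 2<pl (<-trans mad<q (ℝ.L<U M q<M M<3-l))
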